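{- In the external memory model with block size $B$, there is a structure occupying $O(n/B)$ blocks on a set $P$ of $n$ points in rank space (i.e., in $[U]^2$ with $U=O(n)$) such that every top-open range skyline query on $P$ can be answered in $O(1+k/B)$ I/Os in the worst case, where $k$ is the number of reported points. This query cost is asymptotically optimal.
   Context: External memory model: a machine has $M$ words of memory and a disk of unbounded size divided into blocks of $B$ consecutive words. An I/O reads one block from disk into memory or writes $B$ words from memory to a block. The space of a structure is the number of blocks it occupies; the cost of an algorithm is the number of I/Os it performs; CPU time is free. When the universe is $[U]^2$, a machine word has at least $\log_2 U$ bits, and structures may use arbitrary bit manipulation (no indivisibility assumption). For an integer $U>0$, $[U]=\{0,1,\dots,U-1\}$. The universe $[U]^2$ is called rank space when $U=O(n)$. For distinct points $p=(x_p,y_p)$, $q=(x_q,y_q)$, $p$ dominates $q$ if $x_p\ge x_q$ and $y_p\ge y_q$. The skyline of a finite point set consists of its points not dominated by any other point of the set. A range skyline query with axis-parallel rectangle $Q$ on $P$ reports the skyline of $P\cap Q$. The query is top-open if $Q=[\alpha_1,\alpha_2]\times[\beta,U]$ with $\alpha_1,\alpha_2,\beta\in[U]$ (the top edge imposes no constraint). Standing assumption: $P$ is in general position, i.e., no two points of $P$ have the same $x$-coordinate or the same $y$-coordinate.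
   Formalization: The upper bound assumes that the memory holds at least a constant number of blocks (M ≥ bB for an absolute constant b); without such a relation between M and B no block need fit in memory and the claim fails. -}

module Defs where

open import Data.Fin.Base using (Fin; toℕ; inject≤; _↑ʳ_)
import Data.Fin.Properties as Fin
open import Data.List.Base as List using (List; []; _∷_; _++_; length; filter; concatMap)
open import Data.List.Relation.Binary.Permutation.Propositional using (_↭_)
open import Data.List.Relation.Unary.AllPairs using (AllPairs)
open import Data.List.Relation.Unary.Any using (Any; any?)
open import Data.Nat.Base using (ℕ; zero; suc; _+_; _*_; _^_; _∸_; _/_; _≤_; _<_; NonZero)
open import Data.Nat.Properties using (_≤?_; _≟_)
open import Data.Product.Base using (Σ; ∃-syntax; _×_; _,_; proj₁; proj₂)
open import Data.Product.Properties using (≡-dec)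
open import Data.Vec.Base as Vec using (Vec; []; _∷_)
open import Relation.Binary.Definitions using (DecidableEquality)
open import Relation.Binary.PropositionalEquality using (_≡_; _≢_)
open import Relation.Nullary using (¬_; Dec; ¬?; _×-dec_; yes; no)

⌈_/_⌉ : (n d : ℕ) .{{_ : NonZero d}} → ℕ
⌈ n / d ⌉ = (n + (d ∸ 1)) / d

------------------------------------------------------------------------
-- Points and range skylines

Point : ℕ → Set
Point U = Fin U × Fin U

module _ {U : ℕ} where

  xOf yOf : Point U → ℕ
  xOf p = toℕ (proj₁ p)
  yOf p = toℕ (proj₂ p)

  _≟ₚ_ : DecidableEquality (Point U)
  _≟ₚ_ = ≡-dec Fin._≟_ Fin._≟_

  Dominates : Point U → Point U → Set
  Dominates p q = p ≢ q × xOf q ≤ xOf p × yOf q ≤ yOf p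

  dominates? : ∀ p q → Dec (Dominates p q)
  dominates? p q = ¬? (p ≟ₚ q) ×-dec (xOf q ≤? xOf p) ×-dec (yOf q ≤? yOf p)

  DominatedIn : List (Point U) → Point U → Set
  DominatedIn S p = Any (λ q → Dominates q p) S

  dominatedIn? : ∀ S p → Dec (DominatedIn S p)
  dominatedIn? S p = any? (λ q → dominates? q p) S

  skyline : List (Point U) → List (Point U)
  skyline S = filter (λ p → ¬? (dominatedIn? S p)) S

record Rectangle : Set where
  constructor [_,_]×[_,_]
  field
    left right bottom top : ℕ

_∈ᴿ_ : ∀ {U} → Point U → Rectangle → Set
p ∈ᴿ [ l , r ]×[ b , t ] = (l ≤ xOf p × xOf p ≤ r) × (b ≤ yOf p × yOf p ≤ t)

_∈ᴿ?_ : ∀ {U} (p : Point U) (Q : Rectangle) → Dec (p ∈ᴿ Q)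
p ∈ᴿ? [ l , r ]×[ b , t ] =
  ((l ≤? xOf p) ×-dec (xOf p ≤? r)) ×-dec ((b ≤? yOf p) ×-dec (yOf p ≤? t))

record TopOpenQuery (U : ℕ) : Set where
  field
    α₁ α₂ β : Fin U

  rectangle : Rectangle
  rectangle = [ toℕ α₁ , toℕ α₂ ]×[ toℕ β , U ]

record PointSet (U n : ℕ) : Set where
  field
    points          : List (Point U)
    size            : length points ≡ n
    generalPosition : AllPairs (λ p q → xOf p ≢ xOf q × yOf p ≢ yOf q) points

rangeSkyline : ∀ {U n} → PointSet U n → TopOpenQuery U → List (Point U)
rangeSkyline P q =
  skyline (filter (_∈ᴿ? TopOpenQuery.rectangle q) (PointSet.points P))

outputSize : ∀ {U n} → PointSet U n → TopOpenQuery U → ℕ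
outputSize P q = length (rangeSkyline P q)

-- "U = O(n)" with implied constant C.
RankSpace : (C U n : ℕ) → Set
RankSpace C U n = 0 < U × U ≤ C * n

------------------------------------------------------------------------
-- The external memory model

record Machine : Set where
  field
    memorySize  : ℕ
    blockSize   : ℕ
    wordBits    : ℕ
    {{block≢0}} : NonZero blockSize

instance
  blockSize-nonZero : ∀ {μ} → NonZero (Machine.blockSize μ)
  blockSize-nonZero {μ} = Machine.block≢0 μ

module Model (μ : Machine) where
  open Machine μ renaming (memorySize to M; blockSize to B)

  Word Block Memory Disk : Set
  Word   = Fin (2 ^ wordBits)
  Block  = Vec Word B
  Memory = Vec Word M
  Disk   = ℕ → Block

  fromMemory : (o : ℕ) → o + B ≤ M → Memory → Block
  fromMemory o fits mem = Vec.tabulate λ i → Vec.lookup mem (inject≤ (o ↑ʳ i) fits)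

  -- Overwrites a segment; the truncating clauses are not reached when o + b ≤ m.
  overwrite : ∀ {b m} → (o : ℕ) → Vec Word b → Vec Word m → Vec Word m
  overwrite o       xs       []        = []
  overwrite zero    []       ys        = ys
  overwrite zero    (x ∷ xs) (_ ∷ ys)  = x ∷ overwrite zero xs ys
  overwrite (suc o) xs       (y ∷ ys)  = y ∷ overwrite o xs ys

  setBlock : ℕ → Block → Disk → Disk
  setBlock a blk disk a′ with a ≟ a′
  ... | yes _ = blk
  ... | no  _ = disk a′

  -- Each instruction other than `halt` is one I/O.  The answer to a query goes
  -- to a separate output file on disk: `report` writes a block of B words from
  -- memory, of which the first ℓ are appended to the output (ℓ < B allows for
  -- partially filled blocks).  Reporting is thus charged like any other write,
  -- and precomputed answers cannot be passed off as output without copying.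
  data Instruction : Set where
    read   : (address o : ℕ) → o + B ≤ M → Instruction
    write  : (address o : ℕ) → o + B ≤ M → Instruction
    report : (o : ℕ) → o + B ≤ M → (ℓ : ℕ) → ℓ ≤ B → Instruction
    halt   : Instruction

  -- CPU time is free and words may be manipulated arbitrarily, so computation
  -- between I/Os is an arbitrary function; but all that survives from one I/O
  -- to the next is the M words of memory and one of s program locations.
  record Program (U s : ℕ) : Set where
    field
      start : TopOpenQuery U → Fin s × Memory
      step  : Fin s → Memory → Fin s × Memory × Instruction

  -- Run π l mem disk t out disk′: started at location l, π halts after t I/Os,
  -- having output the words out and leaving the disk as disk′.
  data Run {U s : ℕ} (π : Program U s) :
           Fin s → Memory → Disk → ℕ → List Word → Disk → Set where

    halt : ∀ {l mem disk l′ mem′} →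
      Program.step π l mem ≡ (l′ , mem′ , halt) →
      Run π l mem disk 0 [] disk

    read : ∀ {l mem disk l′ mem′ a o fits t out disk′} →
      Program.step π l mem ≡ (l′ , mem′ , read a o fits) →
      Run π l′ (overwrite o (disk a) mem′) disk t out disk′ →
      Run π l mem disk (suc t) out disk′

    write : ∀ {l mem disk l′ mem′ a o fits t out disk′} →
      Program.step π l mem ≡ (l′ , mem′ , write a o fits) →
      Run π l′ mem′ (setBlock a (fromMemory o fits mem′) disk) t out disk′ →
      Run π l mem disk (suc t) out disk′

    report : ∀ {l mem disk l′ mem′ o fits ℓ ℓ≤B t out disk′} →
      Program.step π l mem ≡ (l′ , mem′ , report o fits ℓ ℓ≤B) →
      Run π l′ mem′ disk t out disk′ →
      Run π l mem disk (suc t)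
        (List.take ℓ (Vec.toList (fromMemory o fits mem′)) ++ out) disk′

  -- The blocks occupy addresses 0, 1, …; the rest of the disk is arbitrary.
  Stores : Disk → List Block → Set
  Stores disk blocks = ∀ i → disk (toℕ i) ≡ List.lookup blocks i

  -- The query program sees P only through the blocks stored on disk.
  record Structure (U n s : ℕ) : Set where
    field
      build   : PointSet U n → List Block
      program : Program U s

    space : PointSet U n → ℕ
    space P = length (build P)

  coordinates : ∀ {U} → Point U → List ℕ
  coordinates p = xOf p ∷ yOf p ∷ []

  module _ {U n s : ℕ} (D : Structure U n s) where
    open Structure D
    open Program program

    -- A query may use the disk as scratch space but must leave the structure
    -- intact.  Points may be reported in any order.
    record Answers (P : PointSet U n) (q : TopOpenQuery U)
                   (disk : Disk) (t : ℕ) : Set where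
      field
        output   : List Word
        disk′    : Disk
        reported : List (Point U)
        run      : Run program (proj₁ (start q)) (proj₂ (start q)) disk t output disk′
        intact   : Stores disk′ (build P)
        encoded  : List.map toℕ output ≡ concatMap coordinates reported
        correct  : reported ↭ rangeSkyline P q

    -- T bounds the worst-case query cost as a function of the output size.
    AnswersWithin : (T : ℕ → ℕ) → Set
    AnswersWithin T =
      ∀ P q disk → Stores disk (build P) →
      ∃[ t ] t ≤ T (outputSize P q) × Answers P q disk t

{-# OPTIONS --safe #-}

-- Upper bound.  Only the first B points (from left to right) of the skyline of the slab
-- [α₁, α₂] × [0, U] matter for the next output block: those above β are a prefix of the
-- answer, and if they all are above β, the query continues to the right of the last one.
-- Such a point remains among the first B when the slab is shrunk around it, so it is enough
-- to store first-B lists for a few canonical slabs covering [α₁, α₂].  Columns are divided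
-- into groups of B and groups into chunks of w + 1, where w is the word length.
--   * Runs of whole chunks: a sparse table, whose w + 1 levels per chunk amount to one
--     list per group.
--   * From a column to a group boundary within a chunk: one word per column marks the groups
--     of the chunk into which a first-B list starting at that column reaches.  If g is the
--     last marked group, the list lies among the last 2B skyline points of the columns up to
--     the end of g, which are stored once per group.
--   * The group of α₂: its points.
-- This is a constant number of blocks per group, hence O(n/B) in total.
--
-- Lower bound.  An I/O reports at most B words.  A query answered with no I/O at all cannot
-- depend on the point set, and exchanging two y-coordinates makes a one-column query empty
-- or nonempty, so queries with empty output cost at least one I/O too.
module Submission where

open import Defs
open import Data.Bool.Base using (Bool; true; false; if_then_else_)
open import Data.Empty using (⊥)
open import Data.Fin.Base using (Fin; toℕ; fromℕ<; fromℕ; zero; suc; funToFin; finToFun; inject≤; _↑ʳ_; _↑ˡ_; splitAt)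
open import Data.Fin.Patterns using (0F; 1F; 2F; 3F; 4F; 5F; 6F)
open import Data.Fin.Permutation.Components using (transpose; transpose-inverse)
open import Data.Fin.Properties using (toℕ<n; toℕ-fromℕ<; finToFun-funToFin; fromℕ<-toℕ; toℕ-inject≤; toℕ-↑ʳ; toℕ-injective; splitAt-↑ˡ; splitAt-↑ʳ; toℕ-fromℕ) renaming (_≟_ to _≟ᶠ_)
open import Data.List.Base as List using (List; []; _∷_; _++_; length; drop; filter; take; concatMap; applyUpTo; cartesianProductWith; allFin)
open import Data.List.Membership.Propositional using (_∈_; lose; find)
open import Data.List.Membership.Propositional.Properties using (∈-++⁺ʳ; ∈-filter⁺; ∈-filter⁻; ∈-cartesianProductWith⁺; ∈-cartesianProductWith⁻; ∈-AllPairs₂; ∈-allFin; ∈-map⁺; ∈-map⁻)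
open import Data.List.Membership.Propositional.Properties.WithK using (unique∧set⇒bag)
open import Data.List.Properties using (filter-none; length-++; length-take; length-drop; length-map; take++drop≡id; ++-assoc; ++-identityʳ; take-all; length-applyUpTo; lookup-applyUpTo)
open import Data.List.Relation.Binary.BagAndSetEquality using (∼bag⇒↭)
open import Data.List.Relation.Binary.Permutation.Propositional using (_↭_; ↭-refl; ↭-trans; ↭-prep; ↭-reflexive; ↭-sym)
open import Data.List.Relation.Binary.Permutation.Propositional.Properties using (↭-length; ++⁺ˡ; ↭-empty-inv)
open import Data.List.Relation.Unary.All as All using (All; []; _∷_)
open import Data.List.Relation.Unary.AllPairs as AllPairs using (AllPairs; []; _∷_)
import Data.List.Relation.Unary.AllPairs.Properties as AllPairs
open import Data.List.Relation.Unary.Any using (Any; here; there; any?)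
open import Data.List.Relation.Unary.Unique.Propositional using (Unique)
import Data.List.Relation.Unary.Unique.Propositional.Properties as Unique
open import Data.Maybe.Base using (Maybe; just; nothing)
open import Data.Nat.Base
open import Data.Nat.DivMod hiding (result)
open import Data.Nat.Properties
open import Data.Product.Base using (Σ; ∃-syntax; _×_; _,_; proj₁; proj₂)
open import Data.Sum.Base using (_⊎_; inj₁; inj₂; [_,_]′)
open import Data.Vec.Base as Vec using (Vec; []; _∷_)
open import Data.Vec.Properties using (lookup∘tabulate; tabulate∘lookup; tabulate-cong; lookup-replicate)
open import Function.Base using (_∘_)
open import Function.Bundles using (mk⇔)
open import Relation.Binary.Definitions using (tri<; tri≈; tri>)
open import Relation.Binary.PropositionalEquality hiding (J)
open import Relation.Nullary using (¬_; Dec; does; yes; no; contradiction; _⊎-dec_; _×-dec_; ¬?)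
open import Relation.Nullary.Decidable using (dec-true)

private variable
  U : ℕ

-- Skylines of slabs, computed from left to right.

DistinctHeights : List (Point U) → Set
DistinctHeights S = ∀ {p q} → p ∈ S → q ∈ S → yOf p ≡ yOf q → p ≡ q

InSlab : ℕ → ℕ → Point U → Set
InSlab l r p = l ≤ xOf p × xOf p < r

inSlab? : ∀ l r (p : Point U) → Dec (InSlab l r p)
inSlab? l r p = (l ≤? xOf p) ×-dec (xOf p <? r)

higher : Point U → Maybe (Point U) → Point U
higher p nothing = p
higher p (just q) with yOf q ≤? yOf p
... | yes _ = p
... | no  _ = q

highest : ℕ → ℕ → List (Point U) → Maybe (Point U)
highest l r [] = nothing
highest l r (p ∷ S) with inSlab? l r p
... | yes _ = just (higher p (highest l r S))
... | no  _ = highest l r S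

data IsHighest (l r : ℕ) (S : List (Point U)) : Maybe (Point U) → Set where
  none : (∀ {p} → p ∈ S → ¬ InSlab l r p) → IsHighest l r S nothing
  some : ∀ {m} → m ∈ S → InSlab l r m →
         (∀ {p} → p ∈ S → InSlab l r p → yOf p ≤ yOf m) → IsHighest l r S (just m)

highest-spec : ∀ l r (S : List (Point U)) → IsHighest l r S (highest l r S)
highest-spec l r [] = none λ ()
highest-spec l r (p ∷ S) with inSlab? l r p
highest-spec l r (p ∷ S) | no p∉ with highest l r S | highest-spec l r S
... | _ | none ∄ = none λ { (here refl) → p∉ ; (there q∈) → ∄ q∈ }
... | _ | some m∈ m-in max =
  some (there m∈) m-in λ { (here refl) q-in → contradiction q-in p∉ ; (there q∈) → max q∈ }
highest-spec l r (p ∷ S) | yes p-in with highest l r S | highest-spec l r S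
... | _ | none ∄ =
  some (here refl) p-in λ { (here refl) _ → ≤-refl ; (there q∈) q-in → contradiction q-in (∄ q∈) }
... | just m | some m∈ m-in max with yOf m ≤? yOf p
...   | yes m≤p = some (here refl) p-in
          λ { (here refl) _ → ≤-refl ; (there q∈) q-in → ≤-trans (max q∈ q-in) m≤p }
...   | no m≰p = some (there m∈) m-in
          λ { (here refl) _ → <⇒≤ (≰⇒> m≰p) ; (there q∈) q-in → max q∈ q-in }

highest-unique : ∀ {l r} {S : List (Point U)} {m} → DistinctHeights S →
  m ∈ S → InSlab l r m → (∀ {p} → p ∈ S → InSlab l r p → yOf p ≤ yOf m) →
  highest l r S ≡ just m
highest-unique {l = l} {r} {S} dh m∈ m-in max with highest l r S | highest-spec l r S
... | _ | none ∄ = contradiction m-in (∄ m∈)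
... | _ | some m′∈ m′-in max′ =
  cong just (dh m′∈ m∈ (≤-antisym (max m′∈ m′-in) (max′ m∈ m-in)))

highest-none : ∀ {l r} {S : List (Point U)} → (∀ {p} → p ∈ S → ¬ InSlab l r p) →
  highest l r S ≡ nothing
highest-none {l = l} {r} {S} ∄ with highest l r S | highest-spec l r S
... | _ | none _ = refl
... | _ | some m∈ m-in _ = contradiction m-in (∄ m∈)

-- The first k points, from left to right, of the skyline of a slab.
stairs : ℕ → ℕ → ℕ → List (Point U) → List (Point U)
stairs zero    l r S = []
stairs (suc k) l r S with highest l r S
... | nothing = []
... | just m  = m ∷ stairs k (suc (xOf m)) r S

stairs-⊆ : ∀ k l r (S : List (Point U)) {p} → p ∈ stairs k l r S → p ∈ S × InSlab l r p
stairs-⊆ (suc k) l r S p∈ with highest l r S | highest-spec l r S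
stairs-⊆ (suc k) l r S (here refl) | _ | some m∈ m-in _ = m∈ , m-in
stairs-⊆ (suc k) l r S (there p∈)  | just m | some m∈ (l≤m , _) _ =
  let p∈S , m<p , p<r = stairs-⊆ k (suc (xOf m)) r S p∈
  in p∈S , ≤-trans l≤m (<⇒≤ m<p) , p<r

stairs-length : ∀ k l r (S : List (Point U)) → length (stairs k l r S) ≤ k
stairs-length zero    l r S = z≤n
stairs-length (suc k) l r S with highest l r S
... | nothing = z≤n
... | just m  = s≤s (stairs-length k _ r S)

-- Every stair moves the left border past its own column.
stairs-width : ∀ k l r (S : List (Point U)) → length (stairs k l r S) ≤ r ∸ l
stairs-width zero    l r S = z≤n
stairs-width (suc k) l r S with highest l r S | highest-spec l r S
... | nothing | _ = z≤n
... | just m  | some _ (l≤m , m<r) _ =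
  ≤-trans (s≤s (stairs-width k (suc (xOf m)) r S))
    (≤-trans (≤-reflexive (sym (∸-suc m<r))) (∸-monoʳ-≤ r l≤m))
  where
  ∸-suc : ∀ {x r} → x < r → r ∸ x ≡ suc (r ∸ suc x)
  ∸-suc {zero}  {suc r} _       = refl
  ∸-suc {suc x} {suc r} (s≤s h) = ∸-suc h

stairs-suc : ∀ k l r (S : List (Point U)) {p} → p ∈ stairs k l r S → p ∈ stairs (suc k) l r S
stairs-suc (suc k) l r S p∈ with highest l r S
stairs-suc (suc k) l r S (here eq)  | just m = here eq
stairs-suc (suc k) l r S (there p∈) | just m = there (stairs-suc k _ r S p∈)

-- No point left of `p` joins the skyline when columns are removed: its dominators would all be
-- removed points to the right of `p`, hence lower than `p`, and then `p` itself dominates it. So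
-- the rank of `p` from the left cannot grow.
stairs-restrict : ∀ k {l r l′ r′} {S : List (Point U)} {p} → DistinctHeights S →
  p ∈ stairs k l r S → l ≤ l′ → r′ ≤ r → InSlab l′ r′ p → p ∈ stairs k l′ r′ S
stairs-restrict (suc k) {l} {r} {l′} {r′} {S} dh p∈ l≤l′ r′≤r p-in
  with highest l r S | highest-spec l r S
stairs-restrict (suc k) {l} {r} {l′} {r′} {S} dh (here refl) l≤l′ r′≤r p-in
  | just m | some m∈ _ max
  rewrite highest-unique {l = l′} {r′} dh m∈ p-in
    (λ q∈ (a , b) → max q∈ (≤-trans l≤l′ a , ≤-trans b r′≤r)) = here refl
stairs-restrict (suc k) {l} {r} {l′} {r′} {S} dh (there p∈) l≤l′ r′≤r p-in@(l′≤p , p<r′)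
  | just m | some m∈ _ max with l′ ≤? xOf m
-- The first stair falls outside the smaller slab, so one unit of `k` is to spare.
... | no l′≰m = stairs-suc k l′ r′ S (stairs-restrict k dh p∈ (≰⇒> l′≰m) r′≤r p-in)
... | yes l′≤m with stairs-⊆ k _ r S p∈
...   | _ , m<p , _
  rewrite highest-unique {l = l′} {r′} dh m∈ (l′≤m , <-trans m<p p<r′)
    (λ q∈ (a , b) → max q∈ (≤-trans l≤l′ a , ≤-trans b r′≤r))
  = there (stairs-restrict k dh p∈ ≤-refl r′≤r (m<p , p<r′))

-- This lets the query work on a few candidates instead of `S`: at each step the highest point of
-- `S` is among them, and no candidate exceeds it.
stairs-cong : ∀ k {l r} {C S : List (Point U)} → DistinctHeights S →
  (∀ {p} → p ∈ stairs k l r S → p ∈ C) → (∀ {p} → p ∈ C → p ∈ S) →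
  stairs k l r C ≡ stairs k l r S
stairs-cong zero dh _ _ = refl
stairs-cong (suc k) {l} {r} {C} {S} dh ⊆C C⊆ with highest l r S | highest-spec l r S
... | nothing | none ∄ rewrite highest-none {l = l} {r} (λ q∈ → ∄ (C⊆ q∈)) = refl
... | just m | some m∈ m-in max
  rewrite highest-unique {l = l} {r} {C} (λ p∈ q∈ → dh (C⊆ p∈) (C⊆ q∈)) (⊆C (here refl)) m-in
    (λ q∈ → max (C⊆ q∈))
  = cong (m ∷_) (stairs-cong k dh (λ p∈ → ⊆C (there p∈)) C⊆)

-- With one unit of fuel per column, `stairs` yields the whole skyline of the slab, whatever the
-- surplus.
stairs-complete : ∀ j k {l r} {S : List (Point U)} → r ∸ l ≤ j → r ∸ l ≤ k →
  stairs j l r S ≡ stairs k l r S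
stairs-complete zero zero _ _ = refl
stairs-complete zero (suc k) {l} {r} {S} r≤l _
  rewrite highest-none {l = l} {r} {S}
    (λ _ (a , b) → <⇒≱ (≤-<-trans a b) (m∸n≡0⇒m≤n (n≤0⇒n≡0 r≤l))) = refl
stairs-complete (suc j) zero {l} {r} {S} _ r≤l
  rewrite highest-none {l = l} {r} {S}
    (λ _ (a , b) → <⇒≱ (≤-<-trans a b) (m∸n≡0⇒m≤n (n≤0⇒n≡0 r≤l))) = refl
stairs-complete (suc j) (suc k) {l} {r} {S} hj hk with highest l r S | highest-spec l r S
... | nothing | _ = refl
... | just m | some _ (l≤m , m<r) _ =
  cong (m ∷_) (stairs-complete j k (shrink hj) (shrink hk))
  where
  shrink : ∀ {i} → r ∸ l ≤ suc i → r ∸ suc (xOf m) ≤ i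
  shrink {i} h = ≤-pred (≤-trans (∸-monoʳ-< (s≤s l≤m) m<r) h)

-- A point is never dominated from its left, so moving the left border only cuts off a prefix of the
-- skyline.
stairs-suffix : ∀ k k′ {l l′ r} {S : List (Point U)} → DistinctHeights S →
  l ≤ l′ → r ∸ l ≤ k → r ∸ l′ ≤ k′ →
  ∃[ pre ] stairs k l r S ≡ pre ++ stairs k′ l′ r S
stairs-suffix zero k′ {l} {l′} {r} {S} dh l≤l′ h h′ =
  [] , trans (stairs-complete zero k′ (≤-trans (∸-monoʳ-≤ r l≤l′) h) h′) refl
stairs-suffix (suc k) k′ {l} {l′} {r} {S} dh l≤l′ h h′ with highest l r S in eq | highest-spec l r S
... | nothing | none ∄ = [] , lem k′
  where
  lem : ∀ k′ → [] ≡ stairs k′ l′ r S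
  lem zero = refl
  lem (suc k′) rewrite highest-none {l = l′} {r} {S} (λ q∈ (a , b) → ∄ q∈ (≤-trans l≤l′ a , b)) = refl
... | just m | some m∈ (l≤m , m<r) max with l′ ≤? xOf m
...   | no l′≰m =
  let pre , e = stairs-suffix k k′ dh (≰⇒> l′≰m)
                  (≤-pred (≤-trans (∸-monoʳ-< (s≤s l≤m) m<r) h)) h′
  in m ∷ pre , cong (m ∷_) e
...   | yes l′≤m = [] , lem k′ h′
  where
  lem : ∀ k′ → r ∸ l′ ≤ k′ → m ∷ stairs k (suc (xOf m)) r S ≡ stairs k′ l′ r S
  lem zero h′ = contradiction (m∸n≡0⇒m≤n (n≤0⇒n≡0 h′)) (<⇒≱ (≤-<-trans l′≤m m<r))
  lem (suc k′) h′
    rewrite highest-unique {l = l′} {r} {S} dh m∈ (l′≤m , m<r)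
      (λ q∈ (a , b) → max q∈ (≤-trans l≤l′ a , b))
    = cong (m ∷_) (stairs-complete k k′
        (≤-pred (≤-trans (∸-monoʳ-< (s≤s l≤m) m<r) h))
        (≤-pred (≤-trans (∸-monoʳ-< (s≤s l′≤m) m<r) h′)))

-- At most `k` stairs come up to and including `z`; the others occupy columns to the right of `z`.
stairs-tail : ∀ k j {l r} {S : List (Point U)} {z} → z ∈ stairs k l r S →
  length (stairs j l r S) ≤ k + (r ∸ suc (xOf z))
stairs-tail (suc k) zero _ = z≤n
stairs-tail (suc k) (suc j) {l} {r} {S} z∈ with highest l r S
stairs-tail (suc k) (suc j) {l} {r} {S} (here refl) | just m =
  s≤s (≤-trans (stairs-width j _ r S) (m≤n+m _ k))
stairs-tail (suc k) (suc j) {l} {r} {S} (there z∈) | just m = s≤s (stairs-tail k j z∈)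

-- The last skyline points before a border.

final : ∀ {A : Set} → ℕ → List A → List A
final k xs = drop (length xs ∸ k) xs

∈-final : ∀ {A : Set} {x : A} k pre {xs} → length xs ≤ k → x ∈ xs → x ∈ final k (pre ++ xs)
∈-final k [] {xs} h x∈ rewrite m≤n⇒m∸n≡0 h = x∈
∈-final {x = x} k (p ∷ pre) {xs} h x∈ with length (pre ++ xs) ≤? k
... | yes short = go (suc (length (pre ++ xs)) ∸ k) bound
  where
  bound : suc (length (pre ++ xs)) ∸ k ≤ 1
  bound = ≤-trans (∸-monoˡ-≤ k (s≤s short)) (≤-reflexive (m+n∸n≡m 1 k))
  go : ∀ d → d ≤ 1 → x ∈ drop d (p ∷ pre ++ xs)
  go zero _ = there (∈-++⁺ʳ pre x∈)
  go (suc zero) _ = ∈-++⁺ʳ pre x∈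
  go (suc (suc _)) (s≤s ())
... | no long rewrite +-∸-assoc 1 (<⇒≤ (≰⇒> long)) = ∈-final k pre h x∈

-- If the stairs have a point within distance B of the right border r, then among them
-- at most 2B points of the skyline of [0,r) lie weakly to the right of l.
stairs-⊆-final : ∀ B {l r} {S : List (Point U)} {p} → DistinctHeights S →
  r ≤ l + B ⊎ (∃[ z ] z ∈ stairs B l r S × r ≤ xOf z + B) →
  p ∈ stairs B l r S → p ∈ final (B + B) (stairs r 0 r S)
stairs-⊆-final {U} B {l} {r} {S} {p} dh near p∈
  -- The fuel `B + r` is enough for the whole skyline of the slab, and it is reached from `B` by
  -- repeated use of `stairs-suc`.
  with stairs-suffix r (B + r) {0} {l} {r} {S} dh z≤n ≤-refl
         (≤-trans (m∸n≤m r l) (m≤n+m r B))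
... | pre , e rewrite e = ∈-final (B + B) pre (short near) (grow r)
  where
  grow : ∀ d → p ∈ stairs (B + d) l r S
  grow zero rewrite +-identityʳ B = p∈
  grow (suc d) rewrite +-suc B d = stairs-suc (B + d) l r S (grow d)
  short : _ → length (stairs (B + r) l r S) ≤ B + B
  short (inj₁ r≤) = ≤-trans (stairs-width (B + r) l r S)
    (≤-trans (m≤n+o⇒m∸n≤o r l r≤) (m≤m+n B B))
  short (inj₂ (z , z∈ , r≤)) = ≤-trans (stairs-tail B (B + r) z∈)
    (+-monoʳ-≤ B (m≤n+o⇒m∸n≤o r (suc (xOf z)) (m≤n⇒m≤1+n r≤)))

-- Top-open skylines as sequences of batches of stairs.

advance : ℕ → List (Point U) → ℕ
advance a []       = a
advance a (p ∷ ps) = advance (suc (xOf p)) ps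

-- Heights decrease along stairs, so stopping at the first point below `β` loses no point above it.
above : ℕ → List (Point U) → List (Point U)
above β [] = []
above β (p ∷ ps) with β ≤? yOf p
... | yes _ = p ∷ above β ps
... | no  _ = []

module _ {U : ℕ} {S : List (Point U)} (dh : DistinctHeights S) (S! : Unique S) (α β : ℕ) where

  private
    Rect : ℕ → Rectangle
    Rect a = [ a , α ]×[ β , U ]

    Sky : ℕ → List (Point U)
    Sky a = skyline (filter (_∈ᴿ? Rect a) S)

    Free : ℕ → Point U → Set
    Free a p = ∀ {q} → q ∈ S → q ∈ᴿ Rect a → ¬ Dominates q p

    ∈Sky⁺ : ∀ {a p} → p ∈ S → p ∈ᴿ Rect a → Free a p → p ∈ Sky a
    ∈Sky⁺ {a} {p} p∈ p-in free =
      ∈-filter⁺ (λ p → ¬? (dominatedIn? _ p)) (∈-filter⁺ (_∈ᴿ? Rect a) p∈ p-in)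
        λ dom → let q , q∈ , d = find dom ; q∈S , q-in = ∈-filter⁻ (_∈ᴿ? Rect a) q∈ in free q∈S q-in d

    ∈Sky⁻ : ∀ {a p} → p ∈ Sky a → p ∈ S × p ∈ᴿ Rect a × Free a p
    ∈Sky⁻ {a} {p} p∈ with ∈-filter⁻ (λ p → ¬? (dominatedIn? (filter (_∈ᴿ? Rect a) S) p)) p∈
    ... | p∈′ , free with ∈-filter⁻ (_∈ᴿ? Rect a) p∈′
    ... | p∈S , p-in = p∈S , p-in , λ q∈ q-in d → free (lose (∈-filter⁺ (_∈ᴿ? Rect a) q∈ q-in) d)

    Sky-! : ∀ a → Unique (Sky a)
    Sky-! a = Unique.filter⁺ (λ p → ¬? (dominatedIn? _ p)) (Unique.filter⁺ (_∈ᴿ? Rect a) S!)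

    Sky-empty : ∀ {a} → (∀ {p} → p ∈ S → InSlab a (suc α) p → yOf p < β) → Sky a ≡ []
    Sky-empty {a} low
      rewrite filter-none (_∈ᴿ? Rect a) {xs = S}
        (All.tabulate λ p∈ ((l , r) , b , _) → <⇒≱ (low p∈ (l , s≤s r)) b) = refl

    -- The highest point `m` dominates everything to its left, and points to its right can be
    -- dominated only by points further right.
    Sky-step : ∀ {a m} → m ∈ S → InSlab a (suc α) m →
      (∀ {p} → p ∈ S → InSlab a (suc α) p → yOf p ≤ yOf m) → β ≤ yOf m →
      Sky a ↭ m ∷ Sky (suc (xOf m))
    Sky-step {a} {m} m∈ (a≤m , m<r) max β≤m =
      ∼bag⇒↭ (unique∧set⇒bag (Sky-! a) (All.tabulate m-fresh ∷ Sky-! _) (mk⇔ to from))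
      where
      m-in : m ∈ᴿ Rect a
      m-in = (a≤m , ≤-pred m<r) , β≤m , <⇒≤ (toℕ<n (proj₂ m))
      m-fresh : ∀ {p} → p ∈ Sky (suc (xOf m)) → m ≢ p
      m-fresh p∈ refl with ∈Sky⁻ p∈
      ... | _ , ((m<m , _) , _) , _ = <-irrefl refl m<m
      m-free : Free a m
      m-free q∈ ((l , r) , _) (q≢m , _ , m≤q) =
        q≢m (dh q∈ m∈ (≤-antisym (max q∈ (l , s≤s r)) m≤q))
      to : ∀ {p} → p ∈ Sky a → p ∈ m ∷ Sky (suc (xOf m))
      to {p} p∈ with p ≟ₚ m
      ... | yes refl = here refl
      ... | no p≢m with ∈Sky⁻ p∈
      ...   | p∈S , ((l , r) , bt) , free with xOf p ≤? xOf m
      ...     | yes p≤m = contradiction (p≢m ∘ sym , p≤m , max p∈S (l , s≤s r)) (free m∈ m-in)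
      ...     | no p≰m = there (∈Sky⁺ p∈S ((≰⇒> p≰m , r) , bt)
                  λ q∈ ((l′ , r′) , bt′) → free q∈ ((≤-trans a≤m (<⇒≤ l′) , r′) , bt′))
      from : ∀ {p} → p ∈ m ∷ Sky (suc (xOf m)) → p ∈ Sky a
      from (here refl) = ∈Sky⁺ m∈ m-in m-free
      from (there p∈) with ∈Sky⁻ p∈
      ... | p∈S , ((l , r) , bt) , free =
        ∈Sky⁺ p∈S ((≤-trans a≤m (<⇒≤ l) , r) , bt)
          λ { q∈ ((_ , r′) , bt′) d@(_ , p≤q , _) → free q∈ ((≤-trans l p≤q , r′) , bt′) d }

  -- A batch stays short only when the slab runs empty or its highest point lies below `β`; in both
  -- cases the answer is exhausted.
  batch-correct : ∀ k a → let T = above β (stairs k a (suc α) S) in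
    (length T < k × Sky a ↭ T) ⊎ (length T ≡ k × Sky a ↭ T ++ Sky (advance a T))
  batch-correct zero a = inj₂ (refl , ↭-refl)
  batch-correct (suc k) a with highest a (suc α) S | highest-spec a (suc α) S
  ... | nothing | none ∄ =
    inj₁ (s≤s z≤n , ↭-reflexive (Sky-empty λ p∈ p-in → contradiction p-in (∄ p∈)))
  ... | just m | some m∈ m-in max with β ≤? yOf m
  ...   | no β≰m =
    inj₁ (s≤s z≤n , ↭-reflexive (Sky-empty λ p∈ p-in → ≤-<-trans (max p∈ p-in) (≰⇒> β≰m)))
  ...   | yes β≤m with batch-correct k (suc (xOf m))
  ...     | inj₁ (short , sky) = inj₁ (s≤s short , ↭-trans (Sky-step m∈ m-in max β≤m) (↭-prep m sky))
  ...     | inj₂ (full , sky)  = inj₂ (cong suc full , ↭-trans (Sky-step m∈ m-in max β≤m) (↭-prep m sky))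

-- Division with remainder, searches, bit vectors and padded tables.

m<[1+m/n]*n : ∀ m n .{{_ : NonZero n}} → m < suc (m / n) * n
m<[1+m/n]*n m n = begin-strict
  m                   ≡⟨ m≡m%n+[m/n]*n m n ⟩
  m % n + m / n * n   <⟨ +-monoˡ-< (m / n * n) (m%n<n m n) ⟩
  n + m / n * n       ∎
  where open ≤-Reasoning

[k*n+i]/n≡k : ∀ k {n i} .{{_ : NonZero n}} → i < n → (k * n + i) / n ≡ k
[k*n+i]/n≡k k {n} {i} i<n = begin
  (k * n + i) / n  ≡⟨ +-distrib-/ (k * n) i
    (subst (_< n) (sym (cong₂ _+_ (m*n%n≡0 k n) (m<n⇒m%n≡m i<n))) i<n) ⟩
  k * n / n + i / n  ≡⟨ cong₂ _+_ (m*n/n≡m k n) (m<n⇒m/n≡0 i<n) ⟩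
  k + 0              ≡⟨ +-identityʳ k ⟩
  k                  ∎
  where open ≡-Reasoning

[k*n+i]%n≡i : ∀ k {n i} .{{_ : NonZero n}} → i < n → (k * n + i) % n ≡ i
[k*n+i]%n≡i k {n} {i} i<n = begin
  (k * n + i) % n  ≡⟨ cong (_% n) (+-comm (k * n) i) ⟩
  (i + k * n) % n  ≡⟨ [m+kn]%n≡m%n i k n ⟩
  i % n            ≡⟨ m<n⇒m%n≡m i<n ⟩
  i                ∎
  where open ≡-Reasoning

does-true : ∀ {P : Set} (P? : Dec P) → does P? ≡ true → P
does-true (yes p) _ = p

-- Index 0 is returned untested as a default. This is harmless once some index up to `j` is known to
-- satisfy `D`, as `lastUpTo-spec` requires.
lastUpTo : (ℕ → Bool) → ℕ → ℕ
lastUpTo D zero    = zero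
lastUpTo D (suc j) = if D (suc j) then suc j else lastUpTo D j

record IsLast (D : ℕ → Bool) (s j t : ℕ) : Set where
  constructor isLast
  field
    lower : s ≤ t
    upper : t ≤ j
    holds : D t ≡ true
    last  : ∀ {i} → t < i → i ≤ j → D i ≢ true

lastUpTo-spec : ∀ D {s} j → D s ≡ true → s ≤ j → IsLast D s j (lastUpTo D j)
lastUpTo-spec D zero Ds z≤n = isLast z≤n z≤n Ds λ t<i i≤0 → contradiction t<i (≤⇒≯ i≤0)
lastUpTo-spec D {s} (suc j) Ds s≤j with D (suc j) in eq
... | true  = isLast s≤j ≤-refl eq λ t<i i≤j → contradiction t<i (≤⇒≯ i≤j)
... | false with m≤n⇒m<n∨m≡n s≤j
...   | inj₂ refl = contradiction (trans (sym Ds) eq) λ ()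
...   | inj₁ (s≤s s≤j′) with lastUpTo-spec D j Ds s≤j′
...     | isLast lo up h l = isLast lo (m≤n⇒m≤1+n up) h last′
  where
  last′ : ∀ {i} → _ < i → i ≤ suc j → D i ≢ true
  last′ t<i i≤ with m≤n⇒m<n∨m≡n i≤
  ... | inj₁ (s≤s i≤j) = l t<i i≤j
  ... | inj₂ refl = λ e → contradiction (trans (sym e) eq) λ ()

-- The binary logarithm of `g` rounded down: the level of the sparse table whose runs cover `g`
-- chunks in two pieces.
level : ℕ → ℕ → ℕ
level w g = lastUpTo (λ h → does (2 ^ h ≤? g)) w

level-spec : ∀ w g → 0 < g → g < 2 ^ suc w →
  level w g ≤ w × 2 ^ level w g ≤ g × g < 2 ^ suc (level w g)
level-spec w g 0<g g< with lastUpTo-spec (λ h → does (2 ^ h ≤? g)) {0} w (dec-true (1 ≤? g) 0<g) z≤n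
... | isLast _ up h l = up , below , upper
  where
  below : 2 ^ level w g ≤ g
  below = does-true (2 ^ level w g ≤? g) h
  upper : g < 2 ^ suc (level w g)
  upper with m≤n⇒m<n∨m≡n up
  ... | inj₂ e = subst (λ h → g < 2 ^ suc h) (sym e) g<
  ... | inj₁ lt = ≰⇒> λ le → l ≤-refl lt (dec-true (2 ^ suc (level w g) ≤? g) le)

-- `funToFin` identifies bit strings of length `w` with the numbers below `2 ^ w`, that is, with
-- machine words.
packBits : ∀ {w} → (ℕ → Bool) → Fin (2 ^ w)
packBits {w} b = funToFin {w} {2} λ i → if b (toℕ i) then suc zero else zero

bit : ∀ {w} → Fin (2 ^ w) → ℕ → Bool
bit {w} x i with i <? w
... | no _ = false
... | yes i<w with finToFun {2} {w} x (fromℕ< i<w)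
...   | zero = false
...   | suc _ = true

bit-packBits : ∀ {w} b {i} → i < w → bit {w} (packBits {w} b) i ≡ b i
bit-packBits {w} b {i} lt with i <? w
... | no i≮w = contradiction lt i≮w
... | yes i<w
  rewrite finToFun-funToFin {w} {2} (λ i → if b (toℕ i) then suc zero else zero) (fromℕ< i<w)
        | toℕ-fromℕ< i<w with b i
...   | true = refl
...   | false = refl

entry : {A : Set} → A → List A → ℕ → A
entry d []       i       = d
entry d (x ∷ xs) zero    = x
entry d (x ∷ xs) (suc i) = entry d xs i

entry-∈ : ∀ {A : Set} {S : List A} {d} → d ∈ S → ∀ {xs} → (∀ {x} → x ∈ xs → x ∈ S) →
  ∀ i → entry d xs i ∈ S
entry-∈ d∈ {[]} sub i = d∈
entry-∈ d∈ {x ∷ xs} sub zero = sub (here refl)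
entry-∈ d∈ {x ∷ xs} sub (suc i) = entry-∈ d∈ (λ x∈ → sub (there x∈)) i

∈-entry : ∀ {A : Set} {x d : A} {xs} → x ∈ xs → ∃[ i ] i < length xs × entry d xs i ≡ x
∈-entry (here refl) = 0 , s≤s z≤n , refl
∈-entry (there x∈) = let i , lt , e = ∈-entry x∈ in suc i , s≤s lt , e

DistinctColumns : List (Point U) → Set
DistinctColumns S = ∀ {p q} → p ∈ S → q ∈ S → xOf p ≡ xOf q → p ≡ q

column : Point U → List (Point U) → ℕ → Point U
column d []      c = d
column d (p ∷ S) c with xOf p ≟ c
... | yes _ = p
... | no  _ = column d S c

column-∈ : ∀ {d} {S S′ : List (Point U)} → d ∈ S′ → (∀ {p} → p ∈ S → p ∈ S′) →
  ∀ c → column d S c ∈ S′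
column-∈ {S = []} d∈ sub c = d∈
column-∈ {S = p ∷ S} d∈ sub c with xOf p ≟ c
... | yes _ = sub (here refl)
... | no  _ = column-∈ d∈ (λ q∈ → sub (there q∈)) c

column-xOf : ∀ {d} {S : List (Point U)} {p} → DistinctColumns S → p ∈ S → column d S (xOf p) ≡ p
column-xOf {S = q ∷ S} {p} dc p∈ with xOf q ≟ xOf p
... | yes e = dc (here refl) p∈ e
column-xOf {S = q ∷ S} {p} dc (here refl) | no ne = contradiction refl ne
column-xOf {S = q ∷ S} {p} dc (there p∈)  | no ne = column-xOf (λ a b → dc (there a) (there b)) p∈

∈-drop⁻ : ∀ {A : Set} {x : A} d {xs} → x ∈ drop d xs → x ∈ xs
∈-drop⁻ zero x∈ = x∈
∈-drop⁻ (suc d) {_ ∷ xs} x∈ = there (∈-drop⁻ d x∈)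

length-final : ∀ {A : Set} k (xs : List A) → length (final k xs) ≤ k
length-final k xs rewrite length-drop (length xs ∸ k) xs =
  m≤n+o⇒m∸n≤o (length xs) (length xs ∸ k) (subst (length xs ≤_) (+-comm k _) (m≤n+m∸n (length xs) k))

-- The stored pages, and the proof that seven of them cover a query.

module Grid (B w : ℕ) {{_ : NonZero B}} where

  W : ℕ
  W = suc w

  module _ {U : ℕ} (S : List (Point U)) where

    -- Group t is marked for l if the first B stairs of the slab from l up to the end of
    -- group t reach into group t, or if t is not to the right of l.
    Marked : ℕ → ℕ → Set
    Marked l t = t * B ≤ l ⊎ Any (λ z → t * B ≤ xOf z) (stairs B l (suc t * B) S)

    marked? : ∀ l t → Dec (Marked l t)
    marked? l t = (t * B ≤? l) ⊎-dec any? (λ z → t * B ≤? xOf z) (stairs B l (suc t * B) S)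

    -- A chunk has `w + 1` groups but `w` bits suffice: its first group never lies to the right of
    -- `l` and so is always marked. Bit 0 therefore stands for the second group.
    rowWord : ℕ → Fin (2 ^ w)
    rowWord l = packBits {w} λ i → does (marked? l (suc (l / B / W * W) + i))

    snapshot : ℕ → List (Point U)
    snapshot g = final (B + B) (stairs (suc g * B) 0 (suc g * B) S)

    chunkStairs : ℕ → ℕ → List (Point U)
    chunkStairs a h = stairs B (a * W * B) ((a + 2 ^ h) * W * B) S

    -- Pages `0F` and `1F` are the two halves of the snapshot, `2F` is the group itself by column,
    -- and `3F` is a list of the sparse table. The `W` levels of a chunk are spread over its `W`
    -- groups: group `g` keeps level `g % W` of chunk `g / W`.
    page : Point U → ℕ → Fin 4 → ℕ → Point U
    page d g 0F i = entry d (snapshot g) i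
    page d g 1F i = entry d (snapshot g) (B + i)
    page d g 2F i = column d S (g * B + i)
    page d g 3F i = entry d (chunkStairs (g / W) (g % W)) i

    page-∈ : ∀ {d} → d ∈ S → ∀ g k i → page d g k i ∈ S
    page-∈ {d} d∈ g k i = go k
      where
      snap⊆ : ∀ {x} → x ∈ snapshot g → x ∈ S
      snap⊆ x∈ = proj₁ (stairs-⊆ r 0 r S (∈-drop⁻ (length (stairs r 0 r S) ∸ (B + B)) x∈))
        where r = suc g * B
      go : ∀ k → page d g k i ∈ S
      go 0F = entry-∈ d∈ snap⊆ i
      go 1F = entry-∈ d∈ snap⊆ (B + i)
      go 2F = column-∈ d∈ (λ x∈ → x∈) (g * B + i)
      go 3F = entry-∈ d∈ (λ x∈ → proj₁ (stairs-⊆ B _ _ S x∈)) i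

  -- Decides `Marked` without the point set: comparison with `l` settles the groups not to its
  -- right, and a stored bit settles the rest.
  readMark : Fin (2 ^ w) → ℕ → ℕ → Bool
  readMark x l t with t * B ≤? l
  ... | yes _ = true
  ... | no  _ = bit {w} x (t ∸ suc (l / B / W * W))

  module _ (l r : ℕ) where

    lastGroup firstChunk lastChunk rowColumn : ℕ
    lastGroup  = r / B
    firstChunk = l / B / W
    lastChunk  = lastGroup / W
    rowColumn  = lastChunk * W * B

    -- The right border `r` is exclusive. Both halves of two snapshots serve the stairs that start
    -- at `l` and at the first column of the last chunk; then come the group of the right border and
    -- two runs of `2 ^ h` chunks for the chunks strictly between.
    requests : Fin (2 ^ w) → Fin (2 ^ w) → Fin 7 → ℕ × Fin 4
    requests x y = λ where
        0F → left , 0F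
        1F → left , 1F
        2F → right , 0F
        3F → right , 1F
        4F → lastGroup , 2F
        5F → suc firstChunk * W + h , 3F
        6F → (lastChunk ∸ 2 ^ h) * W + h , 3F
      where
      left right h : ℕ
      -- Only groups before that of the right border are searched, and only up to the last group
      -- `firstChunk * W + w` of the chunk of `l`, where the stored bits end.
      left  = lastUpTo (readMark x l) ((lastGroup ∸ 1) ⊓ (firstChunk * W + w))
      right = lastUpTo (readMark y rowColumn) (lastGroup ∸ 1)
      h     = level w (lastChunk ∸ suc firstChunk)

  module _ {U : ℕ} {S : List (Point U)} (dh : DistinctHeights S) (dc : DistinctColumns S) where

    -- If the comparison fails, `t` lies beyond the group of `l`, hence beyond the first group of
    -- the chunk, and its bit has an index below `w`.
    readMark-correct : ∀ l {t} → l / B ≤ t → t < suc (l / B / W) * W →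
      (readMark (rowWord S l) l t ≡ true → Marked S l t) ×
      (Marked S l t → readMark (rowWord S l) l t ≡ true)
    readMark-correct l {t} l≤t t< with t * B ≤? l
    ... | yes p = (λ _ → inj₁ p) , λ _ → refl
    ... | no ¬p = subst (λ b → (b ≡ true → Marked S l t) × (Marked S l t → b ≡ true))
                    (sym bit≡) (does-true (marked? S l t) , dec-true (marked? S l t))
      where
      base : ℕ
      base = l / B / W * W
      l<t : l / B < t
      l<t = ≰⇒> λ t≤ → ¬p (≤-trans (*-monoˡ-≤ B t≤) (m/n*n≤m l B))
      base<t : suc base ≤ t
      base<t = ≤-trans (s≤s (m/n*n≤m (l / B) W)) l<t
      small : t ∸ suc base < w
      small = ≤-trans (∸-monoˡ-< t< base<t)
        (≤-reflexive (trans (cong (_∸ suc base) (+-comm W base))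
          (trans (cong (_∸ suc base) (+-suc base w)) (m+n∸m≡n (suc base) w))))
      bit≡ : bit {w} (rowWord S l) (t ∸ suc base) ≡ does (marked? S l t)
      bit≡ = trans (bit-packBits {w} (λ i → does (marked? S l (suc base + i))) small)
               (cong (λ t → does (marked? S l t)) (m+[n∸m]≡n base<t))

    -- Let `t` be the last marked group up to `j`; it exists because the group of `l` is marked. By
    -- `stairs-restrict`, `p` remains a stair when the slab ends with the group of `p`, so that
    -- group is marked and is at most `t`. Since `t` is marked, the stairs come close enough to its
    -- end for `stairs-⊆-final`.
    snapshot-cover : ∀ D l j {p} → l / B ≤ j →
      (∀ {t} → l / B ≤ t → t ≤ j → (D t ≡ true → Marked S l t) × (Marked S l t → D t ≡ true)) →
      p ∈ stairs B l (suc j * B) S → p ∈ snapshot S (lastUpTo D j) × lastUpTo D j ≤ j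
    snapshot-cover D l j {p} l≤j D↔ p∈
      with lastUpTo D j | lastUpTo-spec D j (proj₂ (D↔ ≤-refl l≤j) (inj₁ (m/n*n≤m l B))) l≤j
    ... | t | isLast l≤t t≤j Dt last =
      stairs-⊆-final B dh near (restrict (*-monoˡ-≤ B (s≤s u≤t))) , t≤j
      where
      u : ℕ
      u = xOf p / B
      p-in : InSlab l (suc j * B) p
      p-in = proj₂ (stairs-⊆ B l _ S p∈)
      u≤j : u ≤ j
      u≤j = ≤-pred (m<n*o⇒m/o<n (proj₂ p-in))
      restrict : ∀ {t} → suc u * B ≤ suc t * B → {{t ≤ j}} → p ∈ stairs B l (suc t * B) S
      restrict {t} h {{t≤}} = stairs-restrict B dh p∈ ≤-refl (*-monoˡ-≤ B (s≤s t≤))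
        (proj₁ p-in , <-≤-trans (m<[1+m/n]*n (xOf p) B) h)
      instance
        _ = u≤j
        _ = t≤j
      u≤t : u ≤ t
      u≤t = ≮⇒≥ λ t<u → last t<u u≤j (proj₂ (D↔ (/-monoˡ-≤ B (proj₁ p-in)) u≤j)
        (inj₂ (lose (restrict ≤-refl) (m/n*n≤m (xOf p) B))))
      near : suc t * B ≤ l + B ⊎ (∃[ z ] z ∈ stairs B l (suc t * B) S × suc t * B ≤ xOf z + B)
      near with proj₁ (D↔ l≤t t≤j) Dt
      ... | inj₁ t≤l = inj₁ (≤-trans (+-monoʳ-≤ B t≤l) (≤-reflexive (+-comm B l)))
      ... | inj₂ any with find any
      ...   | z , z∈ , t≤z = inj₂ (z , z∈ , ≤-trans (+-monoʳ-≤ B t≤z) (≤-reflexive (+-comm B (xOf z))))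

    module _ {d : Point U} where

      snapshot-paged : ∀ g {p} → p ∈ snapshot S g →
        (∃[ i ] i < B × page S d g 0F i ≡ p) ⊎ (∃[ i ] i < B × page S d g 1F i ≡ p)
      snapshot-paged g p∈ with ∈-entry {d = d} p∈
      ... | i , i< , e with i <? B
      ...   | yes lt = inj₁ (i , lt , e)
      ...   | no ge  = inj₂ (i ∸ B , +-cancelˡ-< B _ _ lt , trans (cong (entry d (snapshot S g)) i≡) e)
        where
        i≡ : B + (i ∸ B) ≡ i
        i≡ = m+[n∸m]≡n (≮⇒≥ ge)
        lt : B + (i ∸ B) < B + B
        lt = subst (_< B + B) (sym i≡) (<-≤-trans i< (length-final (B + B) _))

      chunkStairs-paged : ∀ {a h p} → h ≤ w → p ∈ chunkStairs S a h →
        ∃[ i ] i < B × page S d (a * W + h) 3F i ≡ p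
      chunkStairs-paged {a} {h} {p} h≤w p∈
        rewrite [k*n+i]/n≡k a {W} {h} (s≤s h≤w) | [k*n+i]%n≡i a {W} {h} (s≤s h≤w)
        with ∈-entry {d = d} p∈
      ... | i , i< , e = i , <-≤-trans i< (stairs-length B _ _ S) , e

      -- By cases on the group `u` of `p`: the group of the right border, a group in the chunk of
      -- `l`, one in the last chunk, or one in a chunk strictly between. Each time the slab is
      -- shrunk around `p` to a canonical one.
      cover : ∀ {l r p} → r ≤ U → U ≤ 2 ^ w → p ∈ stairs B l r S →
        let q = requests l r (rowWord S l) (rowWord S (rowColumn l r)) in
        ∃[ m ] ∃[ i ] i < B × proj₁ (q m) ≤ r / B × page S d (proj₁ (q m)) (proj₂ (q m)) i ≡ p
      cover {l} {r} {p} r≤U U≤ p∈ = case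
        where
        j A J u c : ℕ
        j = lastGroup l r
        A = firstChunk l r
        J = lastChunk l r
        u = xOf p / B
        c = u / W
        p∈S : p ∈ S
        p∈S = proj₁ (stairs-⊆ B l r S p∈)
        l≤p : l ≤ xOf p
        l≤p = proj₁ (proj₂ (stairs-⊆ B l r S p∈))
        p<r : xOf p < r
        p<r = proj₂ (proj₂ (stairs-⊆ B l r S p∈))
        j*B≤r : j * B ≤ r
        j*B≤r = m/n*n≤m r B
        J*W≤j : J * W ≤ j
        J*W≤j = m/n*n≤m j W
        u*B≤p : u * B ≤ xOf p
        u*B≤p = m/n*n≤m (xOf p) B
        p<u : xOf p < suc u * B
        p<u = m<[1+m/n]*n (xOf p) B
        l/B≤u : l / B ≤ u
        l/B≤u = /-monoˡ-≤ B l≤p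
        A≤c : A ≤ c
        A≤c = /-monoˡ-≤ W l/B≤u
        c≤J : c ≤ J
        c≤J = /-monoˡ-≤ W (/-monoˡ-≤ B (<⇒≤ p<r))
        u<c : u < suc c * W
        u<c = m<[1+m/n]*n u W
        upTo : ∀ {i k} → u ≤ i → i < j → l ≤ k → k ≤ xOf p → p ∈ stairs B k (suc i * B) S
        upTo u≤i i<j l≤k k≤p = stairs-restrict B dh p∈ l≤k (≤-trans (*-monoˡ-≤ B i<j) j*B≤r)
          (k≤p , <-≤-trans p<u (*-monoˡ-≤ B (s≤s u≤i)))

        Goal : Set
        Goal = let q = requests l r (rowWord S l) (rowWord S (rowColumn l r)) in
          ∃[ m ] ∃[ i ] i < B × proj₁ (q m) ≤ j × page S d (proj₁ (q m)) (proj₂ (q m)) i ≡ p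

        within : u ≡ j → Goal
        within e = 4F , xOf p % B , m%n<n (xOf p) B , ≤-refl ,
          trans (cong (column d S) (trans (+-comm (j * B) _) (trans (cong (λ v → xOf p % B + v * B) (sym e))
            (sym (m≡m%n+[m/n]*n (xOf p) B))))) (column-xOf dc p∈S)

        start : u < j → c ≡ A → Goal
        start u<j e = located (snapshot-cover (readMark (rowWord S l) l) l j₁ (≤-trans l/B≤u u≤j₁)
            (λ l≤t t≤j₁ → readMark-correct l l≤t (≤-<-trans (≤-trans t≤j₁ (m⊓n≤n (j ∸ 1) _))
              (≤-reflexive (trans (cong suc (+-comm (A * W) w)) refl))))
            (upTo u≤j₁ (≤-<-trans (m⊓n≤m (j ∸ 1) _) j∸1<j) ≤-refl l≤p))
          where
          j₁ : ℕ
          j₁ = (j ∸ 1) ⊓ (A * W + w)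
          j∸1<j : j ∸ 1 < j
          j∸1<j = ≤-reflexive (m+[n∸m]≡n (≤-trans (s≤s z≤n) u<j))
          u≤j₁ : u ≤ j₁
          u≤j₁ = ⊓-glb (∸-monoˡ-≤ 1 u<j)
            (≤-pred (≤-trans (subst (λ c → u < suc c * W) e u<c)
              (≤-reflexive (cong suc (+-comm w (A * W))))))
          located : p ∈ snapshot S (lastUpTo (readMark (rowWord S l) l) j₁) × lastUpTo (readMark (rowWord S l) l) j₁ ≤ j₁ → Goal
          located (p∈snap , t≤) with snapshot-paged (lastUpTo (readMark (rowWord S l) l) j₁) p∈snap
          ... | inj₁ (i , lt , eq) = 0F , i , lt , ≤-trans t≤ (≤-trans (m⊓n≤m (j ∸ 1) _) (m∸n≤m j 1)) , eq
          ... | inj₂ (i , lt , eq) = 1F , i , lt , ≤-trans t≤ (≤-trans (m⊓n≤m (j ∸ 1) _) (m∸n≤m j 1)) , eq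

        -- The left border moves to the first column of the last chunk. It lies between `l` and `p`,
        -- and its own mark word is the second word read.
        end : u < j → A < c → c ≡ J → Goal
        end u<j A<c e = located (snapshot-cover (readMark (rowWord S k) k) k (j ∸ 1)
            (≤-trans (/-monoˡ-≤ B k≤p) (∸-monoˡ-≤ 1 u<j))
            (λ k≤t t≤ → readMark-correct k k≤t (≤-<-trans t≤ (<-≤-trans j∸1<j
              (<⇒≤ (subst (λ v → j < suc v * W) (sym k-chunk) (m<[1+m/n]*n j W))))))
            (upTo (∸-monoˡ-≤ 1 u<j) j∸1<j l≤k k≤p))
          where
          k : ℕ
          k = rowColumn l r
          k-chunk : k / B / W ≡ J
          k-chunk = trans (cong (_/ W) (m*n/n≡m (J * W) B)) (m*n/n≡m J W)
          j∸1<j : j ∸ 1 < j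
          j∸1<j = ≤-reflexive (m+[n∸m]≡n (≤-trans (s≤s z≤n) u<j))
          k≤p : k ≤ xOf p
          k≤p = ≤-trans (*-monoˡ-≤ B (subst (λ v → v * W ≤ u) e (m/n*n≤m u W))) u*B≤p
          l≤k : l ≤ k
          l≤k = <⇒≤ (<-≤-trans (m<[1+m/n]*n l B) (*-monoˡ-≤ B
            (≤-trans (m<[1+m/n]*n (l / B) W) (*-monoˡ-≤ W (subst (A <_) e A<c)))))
          located : p ∈ snapshot S (lastUpTo (readMark (rowWord S k) k) (j ∸ 1)) × lastUpTo (readMark (rowWord S k) k) (j ∸ 1) ≤ j ∸ 1 → Goal
          located (p∈snap , t≤) with snapshot-paged (lastUpTo (readMark (rowWord S k) k) (j ∸ 1)) p∈snap
          ... | inj₁ (i , lt , eq) = 2F , i , lt , ≤-trans t≤ (m∸n≤m j 1) , eq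
          ... | inj₂ (i , lt , eq) = 3F , i , lt , ≤-trans t≤ (m∸n≤m j 1) , eq

        middle : A < c → c < J → Goal
        middle A<c c<J = pick
          where
          h : ℕ
          h = level w (J ∸ suc A)
          -- The number of chunks is bounded by `U`, hence by `2 ^ w`, so the level is one of the
          -- `w + 1` stored ones.
          g< : J ∸ suc A < 2 ^ suc w
          g< = ≤-<-trans (≤-trans (m∸n≤m J (suc A)) (≤-trans (m/n≤m j W)
                 (≤-trans (m/n≤m r B) (≤-trans r≤U U≤)))) (^-monoʳ-< 2 (s≤s (s≤s z≤n)) (n<1+n w))
          spec : h ≤ w × 2 ^ h ≤ J ∸ suc A × J ∸ suc A < 2 ^ suc h
          spec = level-spec w (J ∸ suc A) (m<n⇒0<n∸m (≤-<-trans A<c c<J)) g<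
          h≤w : h ≤ w
          h≤w = proj₁ spec
          low : 2 ^ h ≤ J ∸ suc A
          low = proj₁ (proj₂ spec)
          high : J ∸ suc A < 2 ^ suc h
          high = proj₂ (proj₂ spec)
          l≤a : l ≤ suc A * W * B
          l≤a = <⇒≤ (<-≤-trans (m<[1+m/n]*n l B) (*-monoˡ-≤ B (m<[1+m/n]*n (l / B) W)))
          J≤r : J * W * B ≤ r
          J≤r = ≤-trans (*-monoˡ-≤ B J*W≤j) j*B≤r
          fits : ∀ {a} → a < J → a * W + h ≤ j
          fits {a} a<J = ≤-trans (+-monoʳ-≤ (a * W) (m≤n⇒m≤1+n h≤w))
            (≤-trans (≤-reflexive (+-comm (a * W) W)) (≤-trans (*-monoˡ-≤ W a<J) J*W≤j))
          pow≤J : suc A + 2 ^ h ≤ J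
          pow≤J = ≤-trans (+-monoʳ-≤ (suc A) low) (≤-reflexive (m+[n∸m]≡n (<⇒≤ (≤-<-trans A<c c<J))))
          2^h≤J : 2 ^ h ≤ J
          2^h≤J = ≤-trans (m≤n+m _ (suc A)) pow≤J
          -- The two runs leave no gap, because fewer than `2 ^ suc h` chunks lie between.
          J≤ : J ∸ 2 ^ h ≤ suc A + 2 ^ h
          J≤ = m≤n+o⇒m∸n≤o J (2 ^ h) (begin
            J                          ≡⟨ sym (m+[n∸m]≡n (<⇒≤ (≤-<-trans A<c c<J))) ⟩
            suc A + (J ∸ suc A)        ≤⟨ +-monoʳ-≤ (suc A) (<⇒≤ high) ⟩
            suc A + (2 ^ h + (2 ^ h + 0)) ≡⟨ cong (λ v → suc A + (2 ^ h + v)) (+-identityʳ (2 ^ h)) ⟩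
            suc A + (2 ^ h + 2 ^ h)    ≡⟨ sym (+-assoc (suc A) (2 ^ h) (2 ^ h)) ⟩
            suc A + 2 ^ h + 2 ^ h      ≡⟨ +-comm (suc A + 2 ^ h) (2 ^ h) ⟩
            2 ^ h + (suc A + 2 ^ h)    ∎)
            where open ≤-Reasoning
          pick : Goal
          pick with c <? suc A + 2 ^ h
          ... | yes c< with chunkStairs-paged {a = suc A} h≤w (stairs-restrict B dh p∈ l≤a
                  (≤-trans (*-monoˡ-≤ B (*-monoˡ-≤ W pow≤J)) J≤r)
                  (≤-trans (*-monoˡ-≤ B (≤-trans (*-monoˡ-≤ W A<c) (m/n*n≤m u W))) u*B≤p
                  , <-≤-trans p<u (*-monoˡ-≤ B (≤-trans u<c (*-monoˡ-≤ W c<)))))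
          ...   | i , lt , eq = 5F , i , lt , fits (≤-<-trans A<c c<J) , eq
          pick | no c≮ with chunkStairs-paged {a = J ∸ 2 ^ h} h≤w (stairs-restrict B dh p∈
                  (≤-trans l≤a (*-monoˡ-≤ B (*-monoˡ-≤ W (m+n≤o⇒m≤o∸n (suc A) pow≤J))))
                  (≤-trans (≤-reflexive (cong (λ v → v * W * B) (m∸n+n≡m 2^h≤J))) J≤r)
                  (≤-trans (*-monoˡ-≤ B (≤-trans (*-monoˡ-≤ W (≤-trans J≤ (≮⇒≥ c≮))) (m/n*n≤m u W))) u*B≤p
                  , <-≤-trans p<u (*-monoˡ-≤ B (≤-trans u<c (*-monoˡ-≤ W
                      (≤-trans c<J (≤-reflexive (sym (m∸n+n≡m 2^h≤J)))))))))
          ...   | i , lt , eq = 6F , i , lt , fits (∸-monoʳ-< {J} (m^n>0 2 h) 2^h≤J) , eq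

        case : Goal
        case with m≤n⇒m<n∨m≡n (/-monoˡ-≤ B (<⇒≤ p<r))
        ... | inj₂ u≡j = within u≡j
        ... | inj₁ u<j with m≤n⇒m<n∨m≡n A≤c
        ...   | inj₂ A≡c = start u<j (sym A≡c)
        ...   | inj₁ A<c with m≤n⇒m<n∨m≡n c≤J
        ...     | inj₂ c≡J = end u<j A<c c≡J
        ...     | inj₁ c<J = middle A<c c<J

-- The query program: memory slots, coding of points, and the loop over batches.

⌈n+m/n⌉ : ∀ n m .{{_ : NonZero n}} → ⌈ n + m / n ⌉ ≡ suc ⌈ m / n ⌉
⌈n+m/n⌉ n m = begin
  (n + m + (n ∸ 1)) / n            ≡⟨ cong (_/ n) (+-assoc n m (n ∸ 1)) ⟩
  (n + (m + (n ∸ 1))) / n          ≡⟨ m/n≡1+[m∸n]/n (m≤m+n n (m + (n ∸ 1))) ⟩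
  suc ((n + (m + (n ∸ 1)) ∸ n) / n) ≡⟨ cong (λ k → suc (k / n)) (m+n∸m≡n n (m + (n ∸ 1))) ⟩
  suc ((m + (n ∸ 1)) / n)          ∎
  where open ≡-Reasoning

-- The contract between one batch and the loop. Only a full batch may be followed by another, so the
-- output pays for every repetition.
BatchOutcome : ∀ {U} → ℕ → (TopOpenQuery U → List (Point U)) →
  TopOpenQuery U → List (Point U) × Maybe (TopOpenQuery U) → Set
BatchOutcome B target q (T , next) =
  (next ≡ nothing × target q ↭ T) ⊎
  (∃[ q′ ] next ≡ just q′ × length T ≡ B × target q ↭ T ++ target q′)

module Slots (μ : Machine) (slots : ℕ) (fits : slots * Machine.blockSize μ ≤ Machine.memorySize μ) where
  open Machine μ renaming (memorySize to M; blockSize to B)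
  open Model μ

  lookup-overwrite-inside : ∀ {b m} o (xs : Vec Word b) (ys : Vec Word m) (i : Fin b) (j : Fin m) →
    toℕ j ≡ o + toℕ i → Vec.lookup (overwrite o xs ys) j ≡ Vec.lookup xs i
  lookup-overwrite-inside zero (x ∷ xs) (y ∷ ys) zero zero _ = refl
  lookup-overwrite-inside zero (x ∷ xs) (y ∷ ys) (suc i) (suc j) e =
    lookup-overwrite-inside zero xs ys i j (suc-injective e)
  lookup-overwrite-inside (suc o) xs (y ∷ ys) i (suc j) e =
    lookup-overwrite-inside o xs ys i j (suc-injective e)

  lookup-overwrite-outside : ∀ {b m} o (xs : Vec Word b) (ys : Vec Word m) (j : Fin m) →
    toℕ j < o ⊎ o + b ≤ toℕ j → Vec.lookup (overwrite o xs ys) j ≡ Vec.lookup ys j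
  lookup-overwrite-outside zero [] (y ∷ ys) j _ = refl
  lookup-overwrite-outside zero (x ∷ xs) (y ∷ ys) (suc j) (inj₂ (s≤s h)) =
    lookup-overwrite-outside zero xs ys j (inj₂ h)
  lookup-overwrite-outside (suc o) xs (y ∷ ys) zero _ = refl
  lookup-overwrite-outside (suc o) xs (y ∷ ys) (suc j) (inj₁ (s≤s h)) =
    lookup-overwrite-outside o xs ys j (inj₁ h)
  lookup-overwrite-outside (suc o) xs (y ∷ ys) (suc j) (inj₂ (s≤s h)) =
    lookup-overwrite-outside o xs ys j (inj₂ h)

  opaque
    offset : ℕ → ℕ
    offset k = k * B

    offset-suc : ∀ k → offset k + B ≡ offset (suc k)
    offset-suc k = +-comm (k * B) B

    offset-mono : ∀ {j k} → j ≤ k → offset j ≤ offset k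
    offset-mono = *-monoˡ-≤ B

    slot-fits : ∀ {k} → k < slots → offset k + B ≤ M
    slot-fits {k} k< = ≤-trans (≤-reflexive (offset-suc k)) (≤-trans (*-monoˡ-≤ B k<) fits)

  slot : ∀ k → k < slots → Memory → Block
  slot k k< = fromMemory (offset k) (slot-fits k<)

  put : ℕ → Block → Memory → Memory
  put k = overwrite (offset k)

  private
    index : ∀ k (k< : k < slots) (i : Fin B) → toℕ (inject≤ (offset k ↑ʳ i) (slot-fits k<)) ≡ offset k + toℕ i
    index k k< i = trans (toℕ-inject≤ _ (slot-fits k<)) (toℕ-↑ʳ (offset k) i)

  slot-put : ∀ k (k< : k < slots) blk mem → slot k k< (put k blk mem) ≡ blk
  slot-put k k< blk mem = trans
    (tabulate-cong λ i → lookup-overwrite-inside (offset k) blk mem i _ (index k k< i))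
    (tabulate∘lookup blk)

  slot-put-other : ∀ {j} k (k< : k < slots) blk mem → j ≢ k → slot k k< (put j blk mem) ≡ slot k k< mem
  slot-put-other {j} k k< blk mem j≢k =
    tabulate-cong λ i → lookup-overwrite-outside (offset j) blk mem _ (outside i)
    where
    outside : ∀ i → let x = toℕ (inject≤ (offset k ↑ʳ i) (slot-fits k<)) in x < offset j ⊎ offset j + B ≤ x
    outside i rewrite index k k< i with <-cmp k j
    ... | tri< k<j _ _ = inj₁ (<-≤-trans (+-monoʳ-< (offset k) (toℕ<n i))
            (≤-trans (≤-reflexive (offset-suc k)) (offset-mono k<j)))
    ... | tri≈ _ k≡j _ = contradiction (sym k≡j) j≢k
    ... | tri> _ _ j<k = inj₂ (≤-trans (≤-reflexive (offset-suc j))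
            (≤-trans (offset-mono j<k) (m≤m+n (offset k) (toℕ i))))

module Coding (μ : Machine) (U : ℕ) {{_ : NonZero U}} (U≤ : U ≤ 2 ^ Machine.wordBits μ) where
  open Machine μ renaming (memorySize to M; blockSize to B)
  open Model μ

  encode : Fin U → Word
  encode x = inject≤ x U≤

  -- Reduction modulo `U` makes decoding total on arbitrary words.
  decode : Word → Fin U
  decode x = toℕ x mod U

  decode-encode : ∀ x → decode (encode x) ≡ x
  decode-encode x = toℕ-injective (begin
    toℕ (decode (encode x)) ≡⟨ toℕ-fromℕ< _ ⟩
    toℕ (encode x) % U      ≡⟨ cong (_% U) (toℕ-inject≤ x U≤) ⟩
    toℕ x % U               ≡⟨ m<n⇒m%n≡m (toℕ<n x) ⟩
    toℕ x                   ∎)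
    where open ≡-Reasoning

  zeroWord : Word
  zeroWord = encode (0 mod U)

  pad : List Word → Block
  pad xs = Vec.tabulate λ i → entry zeroWord xs (toℕ i)

  take-pad : ∀ xs → length xs ≤ B → take (length xs) (Vec.toList (pad xs)) ≡ xs
  take-pad = go
    where
    go : ∀ {n} xs → length xs ≤ n →
      take (length xs) (Vec.toList (Vec.tabulate {n = n} λ i → entry zeroWord xs (toℕ i))) ≡ xs
    go [] _ = refl
    go (x ∷ xs) (s≤s h) = cong (x ∷_) (go xs h)

  pointWords : List (Point U) → List Word
  pointWords = concatMap λ p → encode (proj₁ p) ∷ encode (proj₂ p) ∷ []

  length-pointWords : ∀ ps → length (pointWords ps) ≡ length ps + length ps
  length-pointWords [] = refl
  length-pointWords (p ∷ ps) = cong suc (trans (cong suc (length-pointWords ps))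
    (sym (+-suc (length ps) (length ps))))

  pointWords-encoded : ∀ ps → List.map toℕ (pointWords ps) ≡ concatMap coordinates ps
  pointWords-encoded [] = refl
  pointWords-encoded (p ∷ ps) = cong₂ _∷_ (toℕ-inject≤ (proj₁ p) U≤)
    (cong₂ _∷_ (toℕ-inject≤ (proj₂ p) U≤) (pointWords-encoded ps))

  pointWords-++ : ∀ ps qs → pointWords (ps ++ qs) ≡ pointWords ps ++ pointWords qs
  pointWords-++ [] qs = refl
  pointWords-++ (p ∷ ps) qs = cong (λ ws → _ ∷ _ ∷ ws) (pointWords-++ ps qs)

-- A query is kept in slots 0–2, the blocks read for it in slots 3–18; slot 19 is the output buffer.
module Batches (μ : Machine) (U : ℕ) {{U≢0 : NonZero U}} (U≤ : U ≤ 2 ^ Machine.wordBits μ)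
  (fits : 20 * Machine.blockSize μ ≤ Machine.memorySize μ)
  (address : TopOpenQuery U → Model.Block μ → Model.Block μ → Fin 16 → ℕ)
  -- Blocks 0 and 1 hold the mark words and are read first, so their addresses may not depend on
  -- what they contain; the other fourteen addresses may.
  (address-01 : ∀ q x y x′ y′ k → toℕ k < 2 → address q x y k ≡ address q x′ y′ k)
  (answer : TopOpenQuery U → Vec (Model.Block μ) 16 → List (Point U) × Maybe (TopOpenQuery U))
  (answer-length : ∀ q bs → length (proj₁ (answer q bs)) ≤ Machine.blockSize μ)
  where
  open Machine μ renaming (memorySize to M; blockSize to B)
  open Model μ
  open Slots μ 20 fits
  open Coding μ U {{U≢0}} U≤

  private
    0< : 0 < 20
    0< = s≤s z≤n
    1< : 1 < 20
    1< = s≤s (s≤s z≤n)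
    2< : 2 < 20
    2< = s≤s (s≤s (s≤s z≤n))

  stored : Block → Fin U
  stored blk = decode (Vec.lookup blk (fromℕ< (>-nonZero⁻¹ B)))

  storage : Fin U → Block
  storage x = Vec.replicate B (encode x)

  stored-storage : ∀ x → stored (storage x) ≡ x
  stored-storage x = trans (cong decode (lookup-replicate (fromℕ< (>-nonZero⁻¹ B)) (encode x))) (decode-encode x)

  query : Memory → TopOpenQuery U
  query mem = record
    { α₁ = stored (slot 0 0< mem)
    ; α₂ = stored (slot 1 1< mem)
    ; β  = stored (slot 2 2< mem)
    }

  putQuery : TopOpenQuery U → Memory → Memory
  putQuery q mem = put 0 (storage α₁) (put 1 (storage α₂) (put 2 (storage β) mem))
    where open TopOpenQuery q

  query-≡ : ∀ {mem q} → let open TopOpenQuery q in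
    slot 0 0< mem ≡ storage α₁ →
    slot 1 1< mem ≡ storage α₂ →
    slot 2 2< mem ≡ storage β →
    query mem ≡ q
  query-≡ {q = q} e₁ e₂ e₃
    with trans (cong stored e₁) (stored-storage _) | trans (cong stored e₂) (stored-storage _)
       | trans (cong stored e₃) (stored-storage _)
  ... | refl | refl | refl = refl

  query-putQuery : ∀ q mem → query (putQuery q mem) ≡ q
  query-putQuery q mem = query-≡ {putQuery q mem} {q}
    (slot-put 0 0< x (put 1 y (put 2 z mem)))
    (trans (slot-put-other {0} 1 1< x (put 1 y (put 2 z mem)) λ ()) (slot-put 1 1< y (put 2 z mem)))
    (trans (slot-put-other {0} 2 2< x (put 1 y (put 2 z mem)) λ ())
      (trans (slot-put-other {1} 2 2< y (put 2 z mem) λ ()) (slot-put 2 2< z mem)))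
    where
    open TopOpenQuery q
    x y z : Block
    x = storage α₁
    y = storage α₂
    z = storage β

  query-put : ∀ k blk mem → 3 ≤ k → query (put k blk mem) ≡ query mem
  query-put (suc (suc (suc k))) blk mem (s≤s (s≤s (s≤s _))) = cong₃
    (λ x y z → record { α₁ = stored x ; α₂ = stored y ; β = stored z })
    (slot-put-other {3 + k} 0 0< blk mem λ ())
    (slot-put-other {3 + k} 1 1< blk mem λ ())
    (slot-put-other {3 + k} 2 2< blk mem λ ())
    where
    cong₃ : ∀ {A D : Set} (f : A → A → A → D) {x x′ y y′ z z′} →
      x ≡ x′ → y ≡ y′ → z ≡ z′ → f x y z ≡ f x′ y′ z′
    cong₃ f refl refl refl = refl

  3+< : (k : Fin 16) → 3 + toℕ k < 20
  3+< k = ≤-trans (+-monoʳ-< 3 (toℕ<n k)) (n≤1+n 19)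

  dataSlot : Memory → Fin 16 → Block
  dataSlot mem k = slot (3 + toℕ k) (3+< k) mem

  dataSlot-put : ∀ k blk mem → dataSlot (put (3 + toℕ k) blk mem) k ≡ blk
  dataSlot-put k blk mem = slot-put (3 + toℕ k) (3+< k) blk mem

  dataSlot-put-other : ∀ {j} k blk mem → j ≢ 3 + toℕ k → dataSlot (put j blk mem) k ≡ dataSlot mem k
  dataSlot-put-other k blk mem = slot-put-other (3 + toℕ k) (3+< k) blk mem

  opaque
    result : Memory → List (Point U) × Maybe (TopOpenQuery U)
    result mem = answer (query mem) (Vec.tabulate (dataSlot mem))

    result-≡ : ∀ {mem q F} → query mem ≡ q → (∀ k → dataSlot mem k ≡ F k) →
      result mem ≡ answer q (Vec.tabulate F)
    result-≡ {q = q} refl F≡ = cong (answer q) (tabulate-cong F≡)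

  reportWords : Memory → List Word → Fin 19 → Fin 19 × Memory × Instruction
  reportWords mem ws l = l , put 19 (pad (take B ws)) mem ,
    report (offset 19) (slot-fits ≤-refl) (length (take B ws))
      (≤-trans (≤-reflexive (length-take B ws)) (m⊓n≤m B (length ws)))

  resume : Maybe (TopOpenQuery U) → Memory → Memory
  resume nothing  mem = mem
  resume (just q) mem = putQuery q mem

  resumeAt : Maybe (TopOpenQuery U) → Fin 19
  resumeAt nothing  = fromℕ< {18} ≤-refl
  resumeAt (just _) = zero

  -- Locations 0 to 15 load one block each, 16 and 17 report the batch, whose at most `B` points
  -- take up to `2B` words, and 18 halts.
  stepAt : ℕ → Memory → Fin 19 × Memory × Instruction
  stepAt n mem with n <? 16
  ... | yes n<16 = fromℕ< {suc n} (≤-trans (s≤s n<16) (m≤n+m 17 2)) , mem ,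
    read (address (query mem) (dataSlot mem 0F) (dataSlot mem 1F) k)
      (offset (3 + toℕ k)) (slot-fits (3+< k))
    where k = fromℕ< n<16
  ... | no _ with n ≟ 16 | n ≟ 17
  ...   | yes _ | _ = reportWords mem (pointWords (proj₁ (result mem))) (fromℕ< {17} (n≤1+n 18))
  -- The rest of the batch is computed from the old query, before `resume` replaces it.
  ...   | no _ | yes _ =
    let T , next = result mem
    in reportWords (resume next mem) (drop B (pointWords T)) (resumeAt next)
  ...   | no _ | no _ = fromℕ< {18} ≤-refl , mem , halt

  program : Program U 19
  program = record
    { start = λ q → zero , putQuery q (Vec.replicate M zeroWord)
    ; step  = λ l → stepAt (toℕ l)
    }

  module _ (disk : Disk) where

    -- The program only reads and reports, so the disk is the same before and after.
    RunFrom : Fin 19 → Memory → ℕ → List Word → Set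
    RunFrom l mem t out = Run program l mem disk t out disk

    -- `F` is the intended content of the sixteen data slots. It is described by a fixed-point
    -- equation, since addresses depend on the first two blocks.
    module _ (q : TopOpenQuery U) (F : Fin 16 → Block)
             (F-read : ∀ k → F k ≡ disk (address q (F 0F) (F 1F) k)) where

      Loaded : ℕ → Memory → Set
      Loaded n mem = query mem ≡ q × (∀ k → toℕ k < n → dataSlot mem k ≡ F k)

      load-step : ∀ {n mem} (n<16 : n < 16) → Loaded n mem → let k = fromℕ< n<16 in
        Loaded (suc n) (put (3 + toℕ k)
          (disk (address (query mem) (dataSlot mem 0F) (dataSlot mem 1F) k)) mem)
      load-step {n} {mem} n<16 (refl , loaded) =
        query-put (3 + toℕ k) blk mem (m≤m+n 3 (toℕ k)) , λ i i< → go i (m≤n⇒m<n∨m≡n (≤-pred i<))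
        where
        k : Fin 16
        k = fromℕ< n<16
        k≡n : toℕ k ≡ n
        k≡n = toℕ-fromℕ< n<16
        blk : Block
        blk = disk (address (query mem) (dataSlot mem 0F) (dataSlot mem 1F) k)
        -- From the third block on, both mark blocks are in memory; before that, the address does
        -- not depend on them.
        same : address (query mem) (dataSlot mem 0F) (dataSlot mem 1F) k ≡ address (query mem) (F 0F) (F 1F) k
        same with 2 ≤? n
        ... | yes 2≤n = cong₂ (λ x y → address (query mem) x y k)
                (loaded 0F (≤-trans (s≤s z≤n) 2≤n)) (loaded 1F 2≤n)
        ... | no ¬2≤n = address-01 _ _ _ _ _ k (subst (_< 2) (sym k≡n) (≰⇒> ¬2≤n))
        go : ∀ i → toℕ i < n ⊎ toℕ i ≡ n → dataSlot (put (3 + toℕ k) blk mem) i ≡ F i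
        go i (inj₁ i<n) = trans (dataSlot-put-other i blk mem
          λ e → <⇒≢ i<n (sym (trans (sym k≡n) (+-cancelˡ-≡ 3 _ _ e)))) (loaded i i<n)
        go i (inj₂ i≡n) with toℕ-injective {i = i} {j = k} (trans i≡n (sym k≡n))
        ... | refl = trans (dataSlot-put k blk mem) (trans (cong disk same) (sym (F-read k)))

      opaque
        -- `Run` describes complete runs only, so a partial run is expressed as a map that extends
        -- any run of the remainder.
        run-loads : ∀ d {n mem} (n+d : n + d ≡ 16) (n<19 : n < 19) → Loaded n mem →
          ∃[ mem′ ] Loaded 16 mem′ ×
            (∀ {t out} → RunFrom (fromℕ< {16} (m≤n+m 17 2)) mem′ t out → RunFrom (fromℕ< n<19) mem (d + t) out)
        run-loads zero {n} {mem} n+d n<19 loaded with trans (sym (+-identityʳ n)) n+d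
        ... | refl = mem , loaded , λ rest → rest
        run-loads (suc d) {n} {mem} n+d n<19 loaded =
          let mem′ , loaded′ , run = run-loads d (trans (sym (+-suc n d)) n+d) (s≤s (≤-trans n<16 (m≤n+m 16 2)))
                                       (load-step {mem = mem} n<16 loaded)
          in mem′ , loaded′ , λ rest → read (step-read _ (toℕ-fromℕ< n<19)) (run rest)
          where
          n<16 : n < 16
          n<16 = ≤-trans (s≤s (m≤m+n n d)) (≤-reflexive (trans (sym (+-suc n d)) n+d))
          step-read : ∀ m → m ≡ n → stepAt m mem ≡ (fromℕ< {suc n} (≤-trans (s≤s n<16) (m≤n+m 17 2)) , mem ,
            read (address (query mem) (dataSlot mem 0F) (dataSlot mem 1F) (fromℕ< n<16))
              (offset (3 + toℕ (fromℕ< n<16))) (slot-fits (3+< (fromℕ< n<16))))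
          step-read m refl with m <? 16
          ... | yes _ = refl
          ... | no ¬p = contradiction n<16 ¬p

      private
        T : List (Point U)
        T = proj₁ (answer q (Vec.tabulate F))
        next : Maybe (TopOpenQuery U)
        next = proj₂ (answer q (Vec.tabulate F))

      result-loaded : ∀ {mem} → Loaded 16 mem → result mem ≡ (T , next)
      result-loaded (q≡ , loaded) = result-≡ q≡ λ k → loaded k (toℕ<n k)

      written : ∀ mem ws → length ws ≤ B + B →
        take (length (take B ws)) (Vec.toList (fromMemory (offset 19) (slot-fits ≤-refl) (put 19 (pad (take B ws)) mem)))
          ≡ take B ws
      written mem ws h = trans
        (cong (λ blk → take (length (take B ws)) (Vec.toList blk)) (slot-put 19 ≤-refl (pad (take B ws)) mem))
        (take-pad (take B ws) (≤-trans (≤-reflexive (length-take B ws)) (m⊓n≤m B _)))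

      opaque
        -- Sixteen reads and two reports make the 18 I/Os.
        run-batch : ∀ {mem} → query mem ≡ q →
          ∃[ mem′ ] (∀ {q′} → next ≡ just q′ → query mem′ ≡ q′) ×
            (∀ {t out} → RunFrom (resumeAt next) mem′ t out → RunFrom zero mem (18 + t) (pointWords T ++ out))
        run-batch {mem} q≡ =
          compose (run-loads 16 refl (s≤s z≤n) (q≡ , λ _ ()))
          where
          ws : List Word
          ws = pointWords T
          ws≤ : length ws ≤ B + B
          ws≤ = ≤-trans (≤-reflexive (length-pointWords T)) (+-mono-≤ (answer-length q _) (answer-length q _))
          rest≤ : length (drop B ws) ≤ B
          rest≤ = ≤-trans (≤-reflexive (length-drop B ws)) (m≤n+o⇒m∸n≤o (length ws) B ws≤)
          ws-split : ∀ {out} → take B ws ++ take B (drop B ws) ++ out ≡ ws ++ out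
          ws-split {out} = trans (sym (++-assoc (take B ws) _ out)) (cong (_++ out) (trans
            (cong (take B ws ++_) (take-all B (drop B ws) rest≤)) (take++drop≡id B ws)))
          resumed : ∀ {q′ blk m} nx → nx ≡ just q′ → query (put 19 blk (resume nx m)) ≡ q′
          resumed {q′} {blk} {m} (just .q′) refl =
            trans (query-put 19 blk (putQuery q′ m) (m≤m+n 3 16)) (query-putQuery q′ m)
          reports : ∀ {mem′} → Loaded 16 mem′ →
            ∃[ mem‴ ] (∀ {q′} → next ≡ just q′ → query mem‴ ≡ q′) ×
              (∀ {t out} → RunFrom (resumeAt next) mem‴ t out →
               RunFrom (fromℕ< {16} (m≤n+m 17 2)) mem′ (2 + t) (ws ++ out))
          reports {mem′} loaded@(q≡′ , F≡) =
            put 19 (pad (take B (drop B ws))) (resume next mem″) , resumed next ,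
            λ {t} {out} rest → subst (RunFrom (fromℕ< {16} (m≤n+m 17 2)) mem′ (2 + t))
            (trans (cong₂ _++_ (written mem′ ws ws≤)
              (cong (_++ out) (written (resume next mem″) (drop B ws) (≤-trans rest≤ (m≤m+n B B))))) ws-split)
            (report step₁ (report step₂ rest))
            where
            mem″ : Memory
            mem″ = put 19 (pad (take B ws)) mem′
            loaded″ : Loaded 16 mem″
            loaded″ = trans (query-put 19 (pad (take B ws)) mem′ (m≤m+n 3 16)) q≡′ ,
              λ k k<16 → trans (dataSlot-put-other k (pad (take B ws)) mem′ λ e → <⇒≢ k<16 (sym (+-cancelˡ-≡ 3 _ _ e))) (F≡ k k<16)
            step₁ : stepAt 16 mem′ ≡ reportWords mem′ ws (fromℕ< {17} (n≤1+n 18))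
            step₁ = cong (λ r → reportWords mem′ (pointWords (proj₁ r)) (fromℕ< {17} (n≤1+n 18)))
                      (result-loaded loaded)
            step₂ : stepAt 17 mem″ ≡ reportWords (resume next mem″) (drop B ws) (resumeAt next)
            step₂ = cong (λ r → reportWords (resume (proj₂ r) mem″) (drop B (pointWords (proj₁ r)))
                                  (resumeAt (proj₂ r)))
                      (result-loaded loaded″)
          compose : (∃[ mem₁ ] Loaded 16 mem₁ ×
              (∀ {t out} → RunFrom (fromℕ< {16} (m≤n+m 17 2)) mem₁ t out → RunFrom zero mem (16 + t) out)) →
            ∃[ mem₂ ] (∀ {q′} → next ≡ just q′ → query mem₂ ≡ q′) ×
              (∀ {t out} → RunFrom (resumeAt next) mem₂ t out → RunFrom zero mem (18 + t) (ws ++ out))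
          compose (mem₁ , loaded , run₁) =
            let mem₂ , q≡′ , run₂ = reports loaded in mem₂ , q≡′ , λ rest → run₁ (run₂ rest)

    module _ (loaded : TopOpenQuery U → Fin 16 → Block)
             (loaded-read : ∀ q k → loaded q k ≡ disk (address q (loaded q 0F) (loaded q 1F) k))
             (target : TopOpenQuery U → List (Point U))
             (correct : ∀ q → BatchOutcome B target q (answer q (Vec.tabulate (loaded q)))) where

      private
        Answered : TopOpenQuery U → Memory → Set
        Answered q mem = ∃[ t ] t ≤ 18 * (1 + ⌈ length (target q) / B ⌉) × ∃[ reported ]
          RunFrom zero mem t (pointWords reported) × reported ↭ target q

      -- A full batch removes `B` points from the target, which lowers the rounded-up quotient by
      -- one and pays for 18 I/Os; the summand 1 pays for the last batch. The fuel decreases because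
      -- `B` is positive.
      run-query : ∀ fuel q mem → query mem ≡ q → length (target q) ≤ fuel → Answered q mem
      run-query fuel q mem q≡ ≤fuel
        with answer q (Vec.tabulate (loaded q)) | correct q | run-batch q (loaded q) (loaded-read q) {mem} q≡
      ... | T , .nothing | inj₁ (refl , sky) | _ , _ , run =
        18 , m≤m*n 18 (1 + ⌈ length (target q) / B ⌉) , T ,
        subst (RunFrom zero mem 18) (++-identityʳ (pointWords T)) (run (halt refl)) , ↭-sym sky
      ... | T , .(just q′) | inj₂ (q′ , refl , full , sky) | mem′ , q≡′ , run = more fuel ≤fuel
        where
        size≡ : length (target q) ≡ B + length (target q′)
        size≡ = trans (↭-length sky) (trans (length-++ T) (cong (_+ length (target q′)) full))
        more : ∀ fuel → length (target q) ≤ fuel → Answered q mem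
        more zero h = contradiction (≤-trans (≤-reflexive (sym size≡)) h)
          (<⇒≱ (<-≤-trans (>-nonZero⁻¹ B) (m≤m+n B _)))
        more (suc fuel) h with run-query fuel q′ mem′ (q≡′ refl)
          (≤-pred (≤-trans (+-monoˡ-≤ (length (target q′)) (>-nonZero⁻¹ B)) (≤-trans (≤-reflexive (sym size≡)) h)))
        ... | t , t≤ , reported , run′ , perm =
          18 + t , bound , T ++ reported ,
          subst (RunFrom zero mem (18 + t)) (sym (pointWords-++ T reported)) (run run′) ,
          ↭-trans (++⁺ˡ T perm) (↭-sym sky)
          where
          bound : 18 + t ≤ 18 * (1 + ⌈ length (target q) / B ⌉)
          bound = begin
            18 + t                                     ≤⟨ +-monoʳ-≤ 18 t≤ ⟩
            18 + 18 * (1 + ⌈ length (target q′) / B ⌉) ≡⟨ sym (*-suc 18 (1 + ⌈ length (target q′) / B ⌉)) ⟩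
            18 * suc (1 + ⌈ length (target q′) / B ⌉)  ≡⟨ cong (λ k → 18 * suc k) (sym (⌈n+m/n⌉ B (length (target q′)))) ⟩
            18 * (1 + ⌈ B + length (target q′) / B ⌉)  ≡⟨ cong (λ k → 18 * (1 + ⌈ k / B ⌉)) (sym size≡) ⟩
            18 * (1 + ⌈ length (target q) / B ⌉)       ∎
            where open ≤-Reasoning

-- The structure on disk and its correctness.

module _ {U n : ℕ} (P : PointSet U n) where
  open PointSet P

  distinctHeights : DistinctHeights points
  distinctHeights p∈ q∈ y≡ with ∈-AllPairs₂ generalPosition p∈ q∈
  ... | inj₁ p≡q = p≡q
  ... | inj₂ (inj₁ (_ , y≢)) = contradiction y≡ y≢
  ... | inj₂ (inj₂ (_ , y≢)) = contradiction (sym y≡) y≢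

  distinctColumns : DistinctColumns points
  distinctColumns p∈ q∈ x≡ with ∈-AllPairs₂ generalPosition p∈ q∈
  ... | inj₁ p≡q = p≡q
  ... | inj₂ (inj₁ (x≢ , _)) = contradiction x≡ x≢
  ... | inj₂ (inj₂ (x≢ , _)) = contradiction (sym x≡) x≢

  points-! : Unique points
  points-! = AllPairs.map (λ (x≢ , _) p≡q → x≢ (cong xOf p≡q)) generalPosition

above-length : ∀ {U} β (ps : List (Point U)) → length (above β ps) ≤ length ps
above-length β [] = z≤n
above-length β (p ∷ ps) with β ≤? yOf p
... | yes _ = s≤s (above-length β ps)
... | no  _ = z≤n

-- Nine blocks per group: the mark words of its `B` columns and, for each of the four pages, the
-- coordinates in two separate blocks.
data Part : Set where
  row   : Part
  abscissae ordinates : Fin 4 → Part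

partIndex : Part → ℕ
partIndex row    = 0
partIndex (abscissae k) = 1 + toℕ k
partIndex (ordinates k) = 5 + toℕ k

partIndex<9 : ∀ p → partIndex p < 9
partIndex<9 row    = s≤s z≤n
partIndex<9 (abscissae k) = s≤s (≤-trans (toℕ<n k) (m≤m+n 4 4))
partIndex<9 (ordinates k) = +-monoʳ-< 5 (toℕ<n k)

partAt : ℕ → Part
partAt 1 = abscissae 0F
partAt 2 = abscissae 1F
partAt 3 = abscissae 2F
partAt 4 = abscissae 3F
partAt 5 = ordinates 0F
partAt 6 = ordinates 1F
partAt 7 = ordinates 2F
partAt 8 = ordinates 3F
partAt _ = row

partAt-partIndex : ∀ p → partAt (partIndex p) ≡ p
partAt-partIndex row = refl
partAt-partIndex (abscissae 0F) = refl
partAt-partIndex (abscissae 1F) = refl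
partAt-partIndex (abscissae 2F) = refl
partAt-partIndex (abscissae 3F) = refl
partAt-partIndex (ordinates 0F) = refl
partAt-partIndex (ordinates 1F) = refl
partAt-partIndex (ordinates 2F) = refl
partAt-partIndex (ordinates 3F) = refl

module Construction (μ : Machine) (U n : ℕ) {{U≢0 : NonZero U}} (0<n : 0 < n)
  (U≤ : U ≤ 2 ^ Machine.wordBits μ)
  (fits : 20 * Machine.blockSize μ ≤ Machine.memorySize μ) where
  open Machine μ renaming (memorySize to M; blockSize to B; wordBits to w)
  open Model μ
  open Coding μ U {{U≢0}} U≤
  open Grid B w {{block≢0}}

  -- The exclusive right border may equal `U`, so the group of column `U` has a record as well.
  lastRecord : ℕ
  lastRecord = U / B

  -- A request that does not matter for the query may lie past the last group. Clamped, it still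
  -- yields points of the set; requests within the bound of `cover` are unaffected.
  location : ℕ → Part → ℕ
  location g p = (g ⊓ lastRecord) * 9 + partIndex p

  -- Pages are padded with a point of the set, so that every stored entry decodes to a point.
  padding : List (Point U) → Point U
  padding []      = 0 mod U , 0 mod U
  padding (p ∷ _) = p

  recordBlock : List (Point U) → ℕ → Part → Block
  recordBlock S g row    = Vec.tabulate λ i → rowWord S (g * B + toℕ i)
  recordBlock S g (abscissae k) = Vec.tabulate λ i → encode (proj₁ (page S (padding S) g k (toℕ i)))
  recordBlock S g (ordinates k) = Vec.tabulate λ i → encode (proj₂ (page S (padding S) g k (toℕ i)))

  blockAt : List (Point U) → ℕ → Block
  blockAt S a = recordBlock S (a / 9) (partAt (a % 9))

  build : PointSet U n → List Block
  build P = applyUpTo (blockAt (PointSet.points P)) (suc lastRecord * 9)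

  length-build : ∀ P → length (build P) ≡ suc lastRecord * 9
  length-build P = length-applyUpTo (blockAt (PointSet.points P)) (suc lastRecord * 9)

  stored-block : ∀ P disk → Stores disk (build P) → ∀ g p →
    disk (location g p) ≡ recordBlock (PointSet.points P) (g ⊓ lastRecord) p
  stored-block P disk stores g p = begin
    disk a                                   ≡⟨ cong disk (sym toℕ-i) ⟩
    disk (toℕ i)                             ≡⟨ stores i ⟩
    List.lookup (build P) i                  ≡⟨ lookup-applyUpTo (blockAt S) (suc lastRecord * 9) i ⟩
    blockAt S (toℕ i)                        ≡⟨ cong (blockAt S) toℕ-i ⟩
    recordBlock S (a / 9) (partAt (a % 9))   ≡⟨ cong₂ (recordBlock S) ([k*n+i]/n≡k (g ⊓ lastRecord) (partIndex<9 p))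
      (trans (cong partAt ([k*n+i]%n≡i (g ⊓ lastRecord) (partIndex<9 p))) (partAt-partIndex p)) ⟩
    recordBlock S (g ⊓ lastRecord) p         ∎
    where
    open ≡-Reasoning
    S : List (Point U)
    S = PointSet.points P
    a : ℕ
    a = location g p
    a< : a < length (build P)
    a< = subst (a <_) (sym (length-build P))
      (<-≤-trans (+-monoʳ-< ((g ⊓ lastRecord) * 9) (partIndex<9 p))
        (≤-trans (≤-reflexive (+-comm ((g ⊓ lastRecord) * 9) 9)) (*-monoˡ-≤ 9 (s≤s (m⊓n≤n g lastRecord)))))
    i : Fin (length (build P))
    i = fromℕ< a<
    toℕ-i : toℕ i ≡ a
    toℕ-i = toℕ-fromℕ< a<

  module _ (q : TopOpenQuery U) where
    open TopOpenQuery q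

    l r k : ℕ
    l = toℕ α₁
    r = suc (toℕ α₂)
    k = rowColumn l r

    wantedBlock : (Fin 4 → Part) → Block → Block → Fin 7 → ℕ
    wantedBlock part x y m = location (proj₁ (wanted m)) (part (proj₂ (wanted m)))
      where
      wanted : Fin 7 → ℕ × Fin 4
      wanted = requests l r (Vec.lookup x (l mod B)) (Vec.lookup y (k mod B))

    -- The sixteen blocks are 2 + 7 + 7: two rows of mark words, then abscissae and ordinates of the
    -- seven requested pages.
    address : Block → Block → Fin 16 → ℕ
    address x y 0F = location (l / B) row
    address x y 1F = location (k / B) row
    address x y (suc (suc m)) = [ wantedBlock abscissae x y , wantedBlock ordinates x y ]′ (splitAt 7 m)

    candidate : Vec Block 16 → Fin 7 → Fin B → Point U
    candidate bs m i = decode (Vec.lookup (Vec.lookup bs (2 ↑ʳ (m ↑ˡ 7))) i)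
                     , decode (Vec.lookup (Vec.lookup bs (2 ↑ʳ (7 ↑ʳ m))) i)

    candidates : Vec Block 16 → List (Point U)
    candidates bs = cartesianProductWith (candidate bs) (allFin 7) (allFin B)

    -- A left border at or beyond `U` is not expressible as a query, but then no column remains and
    -- the answer is complete.
    continue : List (Point U) → Maybe (TopOpenQuery U)
    continue T with length T ≟ B | advance l T <? U
    ... | yes _ | yes a<U = just record { α₁ = fromℕ< a<U ; α₂ = α₂ ; β = β }
    ... | yes _ | no _    = nothing
    ... | no _  | _       = nothing

    answer : Vec Block 16 → List (Point U) × Maybe (TopOpenQuery U)
    answer bs = let T = above (toℕ β) (stairs B l r (candidates bs)) in T , continue T

    answer-length : ∀ bs → length (proj₁ (answer bs)) ≤ B
    answer-length bs = ≤-trans (above-length (toℕ β) (stairs B l r (candidates bs))) (stairs-length B l r (candidates bs))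

    address-abscissae : ∀ x y m → address x y (2 ↑ʳ (m ↑ˡ 7)) ≡ wantedBlock abscissae x y m
    address-abscissae x y m = cong [ wantedBlock abscissae x y , wantedBlock ordinates x y ]′ (splitAt-↑ˡ 7 m 7)

    address-ordinates : ∀ x y m → address x y (2 ↑ʳ (7 ↑ʳ m)) ≡ wantedBlock ordinates x y m
    address-ordinates x y m = cong [ wantedBlock abscissae x y , wantedBlock ordinates x y ]′ (splitAt-↑ʳ 7 7 m)

    address-01 : ∀ x y x′ y′ i → toℕ i < 2 → address x y i ≡ address x′ y′ i
    address-01 x y x′ y′ 0F _ = refl
    address-01 x y x′ y′ 1F _ = refl
    address-01 x y x′ y′ (suc (suc m)) (s≤s (s≤s ()))

  module _ (P : PointSet U n) (disk : Disk) (stores : Stores disk (build P)) where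
    private
      S : List (Point U)
      S = PointSet.points P

    padding-∈ : padding S ∈ S
    padding-∈ = go S (subst (0 <_) (sym (PointSet.size P)) 0<n)
      where
      go : ∀ ps → 0 < length ps → padding ps ∈ ps
      go (p ∷ _) _ = here refl

    module _ (q : TopOpenQuery U) where
      open TopOpenQuery q
      private
        a b c : ℕ
        a = l q
        b = r q
        c = k q

      rowBlock : ℕ → Block
      rowBlock column = disk (location (column / B) row)

      -- Components 0 and 1 reduce to `rowBlock a` and `rowBlock c`, so the fixed-point equation
      -- asked for by `run-query` holds by `refl`.
      loaded : Fin 16 → Block
      loaded = λ i → disk (address q (rowBlock a) (rowBlock c) i)

      rowBlock-lookup : ∀ column → column ≤ U → Vec.lookup (rowBlock column) (column mod B) ≡ rowWord S column
      rowBlock-lookup column ≤U = begin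
        Vec.lookup (rowBlock column) (column mod B)
          ≡⟨ cong (λ blk → Vec.lookup blk (column mod B)) (stored-block P disk stores (column / B) row) ⟩
        Vec.lookup (recordBlock S (column / B ⊓ lastRecord) row) (column mod B)
          ≡⟨ lookup∘tabulate _ (column mod B) ⟩
        rowWord S ((column / B ⊓ lastRecord) * B + toℕ (column mod B))
          ≡⟨ cong (rowWord S) (cong₂ (λ g i → g * B + i) (m≤n⇒m⊓n≡m (/-monoˡ-≤ B ≤U)) (toℕ-fromℕ< (m%n<n column B))) ⟩
        rowWord S (column / B * B + column % B)
          ≡⟨ cong (rowWord S) (trans (+-comm _ (column % B)) (sym (m≡m%n+[m/n]*n column B))) ⟩
        rowWord S column ∎
        where open ≡-Reasoning

      wanted : Fin 7 → ℕ × Fin 4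
      wanted = requests a b (rowWord S a) (rowWord S c)

      requestedPoint : Fin 7 → ℕ → Point U
      requestedPoint m = page S (padding S) (proj₁ (wanted m) ⊓ lastRecord) (proj₂ (wanted m))

      b≤U : b ≤ U
      b≤U = toℕ<n α₂

      c≤U : c ≤ U
      c≤U = ≤-trans (*-monoˡ-≤ B (m/n*n≤m (b / B) W)) (≤-trans (m/n*n≤m b B) b≤U)

      loaded-abscissae : ∀ m → loaded (2 ↑ʳ (m ↑ˡ 7)) ≡ recordBlock S (proj₁ (wanted m) ⊓ lastRecord) (abscissae (proj₂ (wanted m)))
      loaded-abscissae m = begin
        disk (address q (rowBlock a) (rowBlock c) (2 ↑ʳ (m ↑ˡ 7)))
          ≡⟨ cong disk (address-abscissae q (rowBlock a) (rowBlock c) m) ⟩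
        at (Vec.lookup (rowBlock a) (a mod B)) (Vec.lookup (rowBlock c) (c mod B))
          ≡⟨ cong₂ at (rowBlock-lookup a (<⇒≤ (toℕ<n α₁))) (rowBlock-lookup c c≤U) ⟩
        at (rowWord S a) (rowWord S c)
          ≡⟨ stored-block P disk stores (proj₁ (wanted m)) (abscissae (proj₂ (wanted m))) ⟩
        recordBlock S (proj₁ (wanted m) ⊓ lastRecord) (abscissae (proj₂ (wanted m))) ∎
        where
        open ≡-Reasoning
        at : Word → Word → Block
        at x y = disk (location (proj₁ (requests a b x y m)) (abscissae (proj₂ (requests a b x y m))))

      loaded-ordinates : ∀ m → loaded (2 ↑ʳ (7 ↑ʳ m)) ≡ recordBlock S (proj₁ (wanted m) ⊓ lastRecord) (ordinates (proj₂ (wanted m)))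
      loaded-ordinates m = begin
        disk (address q (rowBlock a) (rowBlock c) (2 ↑ʳ (7 ↑ʳ m)))
          ≡⟨ cong disk (address-ordinates q (rowBlock a) (rowBlock c) m) ⟩
        at (Vec.lookup (rowBlock a) (a mod B)) (Vec.lookup (rowBlock c) (c mod B))
          ≡⟨ cong₂ at (rowBlock-lookup a (<⇒≤ (toℕ<n α₁))) (rowBlock-lookup c c≤U) ⟩
        at (rowWord S a) (rowWord S c)
          ≡⟨ stored-block P disk stores (proj₁ (wanted m)) (ordinates (proj₂ (wanted m))) ⟩
        recordBlock S (proj₁ (wanted m) ⊓ lastRecord) (ordinates (proj₂ (wanted m))) ∎
        where
        open ≡-Reasoning
        at : Word → Word → Block
        at x y = disk (location (proj₁ (requests a b x y m)) (ordinates (proj₂ (requests a b x y m))))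

      decoded : ∀ m i → candidate q (Vec.tabulate loaded) m i ≡ requestedPoint m (toℕ i)
      decoded m i = cong₂ _,_
        (trans (cong (λ blk → decode (Vec.lookup blk i)) (trans (lookup∘tabulate loaded (2 ↑ʳ (m ↑ˡ 7))) (loaded-abscissae m)))
          (trans (cong decode (lookup∘tabulate _ i)) (decode-encode _)))
        (trans (cong (λ blk → decode (Vec.lookup blk i)) (trans (lookup∘tabulate loaded (2 ↑ʳ (7 ↑ʳ m))) (loaded-ordinates m)))
          (trans (cong decode (lookup∘tabulate _ i)) (decode-encode _)))

      candidates-⊆ : ∀ {p} → p ∈ candidates q (Vec.tabulate loaded) → p ∈ S
      candidates-⊆ p∈ with ∈-cartesianProductWith⁻ (candidate q (Vec.tabulate loaded)) (allFin 7) (allFin B) p∈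
      ... | m , i , _ , _ , refl =
        subst (_∈ S) (sym (decoded m i)) (page-∈ S padding-∈ _ (proj₂ (wanted m)) (toℕ i))

      stairs-⊆-candidates : ∀ {p} → p ∈ stairs B a b S → p ∈ candidates q (Vec.tabulate loaded)
      stairs-⊆-candidates {p} p∈
        with cover (distinctHeights P) (distinctColumns P) {padding S} b≤U U≤ p∈
      ... | m , i , i<B , g≤ , e = subst (_∈ candidates q (Vec.tabulate loaded)) eq
              (∈-cartesianProductWith⁺ (candidate q (Vec.tabulate loaded)) (∈-allFin m) (∈-allFin (fromℕ< i<B)))
        where
        eq = trans (decoded m (fromℕ< i<B)) (trans
          (cong₂ (λ g i → page S (padding S) g (proj₂ (wanted m)) i)
            (m≤n⇒m⊓n≡m (≤-trans g≤ (/-monoˡ-≤ B b≤U))) (toℕ-fromℕ< i<B)) e)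

      private
        Rest : ℕ → List (Point U)
        Rest a′ = skyline (filter (_∈ᴿ? [ a′ , toℕ α₂ ]×[ toℕ β , U ]) S)

      continue-correct : ∀ T →
        (length T < B × rangeSkyline P q ↭ T) ⊎ (length T ≡ B × rangeSkyline P q ↭ T ++ Rest (advance a T)) →
        BatchOutcome B (rangeSkyline P) q (T , continue q T)
      continue-correct T batch with length T ≟ B | advance a T <? U
      continue-correct T (inj₁ (short , sky)) | no _ | _ = inj₁ (refl , sky)
      continue-correct T (inj₁ (short , _)) | yes full | _ = contradiction full (<⇒≢ short)
      continue-correct T (inj₂ (full , _)) | no ¬full | _ = contradiction full ¬full
      continue-correct T (inj₂ (full , sky)) | yes _ | yes a<U =
        inj₂ (_ , refl , full , subst (λ a′ → rangeSkyline P q ↭ T ++ Rest a′) (sym (toℕ-fromℕ< a<U)) sky)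
      continue-correct T (inj₂ (full , sky)) | yes _ | no a≮U =
        inj₁ (refl , ↭-trans sky (↭-reflexive (trans (cong (λ F → T ++ skyline F)
          (filter-none (_∈ᴿ? [ advance a T , toℕ α₂ ]×[ toℕ β , U ]) {xs = S}
            (All.tabulate λ {p} _ ((l≤ , _) , _) → a≮U (≤-<-trans l≤ (toℕ<n (proj₁ p)))))) (++-identityʳ T))))

      -- The candidates lie in the set and include its first `B` stairs, so they produce the same
      -- batch as the whole set.
      answer-correct : BatchOutcome B (rangeSkyline P) q (answer q (Vec.tabulate loaded))
      answer-correct = subst (λ T → BatchOutcome B (rangeSkyline P) q (above (toℕ β) T , continue q (above (toℕ β) T)))
        (sym (stairs-cong B {a} {b} (distinctHeights P) stairs-⊆-candidates candidates-⊆))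
        (continue-correct _ (batch-correct (distinctHeights P) (points-! P) (toℕ α₂) (toℕ β) B a))

  open Slots μ 20 fits
  open Batches μ U {{U≢0}} U≤ fits address address-01 answer answer-length

  structure : Structure U n 19
  structure = record { build = build ; program = program }

  answersWithin : AnswersWithin structure (λ k → 18 * (1 + ⌈ k / B ⌉))
  answersWithin P q disk stores =
    let t , t≤ , reported , run , perm =
          run-query disk (loaded P disk stores) (λ _ _ → refl) (rangeSkyline P) (answer-correct P disk stores)
            (outputSize P q) q (putQuery q (Vec.replicate M zeroWord)) (query-putQuery q (Vec.replicate M zeroWord)) ≤-refl
    in t , t≤ , record
      { output   = pointWords reported
      ; disk′    = disk
      ; reported = reported
      ; run      = run
      ; intact   = stores
      ; encoded  = pointWords-encoded reported
      ; correct  = perm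
      }

-- The lower bound, by exchanging heights and counting output words.

transpose-matchʳ : ∀ {n} (i j : Fin n) → transpose i j j ≡ i
transpose-matchʳ i j with j ≟ᶠ i
... | yes j≡i = j≡i
... | no _ rewrite dec-true (j ≟ᶠ j) refl = refl

transpose-injective : ∀ {n} (i j : Fin n) {x y} → transpose i j x ≡ transpose i j y → x ≡ y
transpose-injective i j {x} {y} e =
  trans (sym (transpose-inverse j i)) (trans (cong (transpose j i) e) (transpose-inverse j i))

firstPoint : ∀ {U n} (P : PointSet U n) → 0 < n → ∃[ p ] p ∈ PointSet.points P
firstPoint record { points = p ∷ _ } _ = p , here refl
firstPoint record { points = [] ; size = refl } ()

∈-rangeSkyline : ∀ {U n} (P : PointSet U n) q {p} → let open TopOpenQuery q in
  p ∈ PointSet.points P → p ∈ᴿ rectangle →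
  (∀ {p′} → p′ ∈ PointSet.points P → p′ ∈ᴿ rectangle → xOf p ≡ xOf p′) →
  p ∈ rangeSkyline P q
∈-rangeSkyline P q {p} p∈ p-in same = ∈-filter⁺ (λ p → ¬? (dominatedIn? Q p))
  (∈-filter⁺ (_∈ᴿ? rectangle) p∈ p-in)
  λ dominated → let p′ , p′∈ , p′≢p , _ = find dominated
                    p′∈S , p′-in = ∈-filter⁻ (_∈ᴿ? rectangle) p′∈
                in p′≢p (sym (distinctColumns P p∈ p′∈S (same p′∈S p′-in)))
  where
  open TopOpenQuery q
  Q = filter (_∈ᴿ? rectangle) (PointSet.points P)

module _ {U n : ℕ} (P : PointSet U n) (from to : Fin U) where
  open PointSet P

  swapHeight : Point U → Point U
  swapHeight (x , y) = x , transpose to from y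

  -- A transposition of heights is injective and leaves columns alone, so general position survives.
  swapHeights : PointSet U n
  swapHeights = record
    { points = List.map swapHeight points
    ; size = trans (length-map swapHeight points) size
    ; generalPosition = AllPairs.map⁺ (AllPairs.map
        (λ (x≢ , y≢) → x≢ , λ e → y≢ (cong toℕ (transpose-injective to from (toℕ-injective e))))
        generalPosition)
    }

  swapHeights-∈ : ∀ {x} → (x , from) ∈ points → (x , to) ∈ List.map swapHeight points
  swapHeights-∈ {x} p∈ = subst (λ y → (x , y) ∈ List.map swapHeight points) (transpose-matchʳ to from) (∈-map⁺ swapHeight p∈)

  swapHeights-unique : ∀ {x y} → (x , from) ∈ points → (x , y) ∈ List.map swapHeight points → y ≡ to
  swapHeights-unique p∈ q∈ with ∈-map⁻ swapHeight q∈
  ... | _ , p′∈ , refl with distinctColumns P p∈ p′∈ refl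
  ...   | refl = transpose-matchʳ to from

module LowerBound (μ : Machine) where
  open Machine μ renaming (memorySize to M; blockSize to B; wordBits to w)
  open Model μ

  run-output : ∀ {U s} {π : Program U s} {l mem disk t out disk′} →
    Run π l mem disk t out disk′ → length out ≤ t * B
  run-output (halt _) = z≤n
  run-output (read _ run) = ≤-trans (run-output run) (m≤n+m _ B)
  run-output (write _ run) = ≤-trans (run-output run) (m≤n+m _ B)
  run-output (report {ℓ = ℓ} {ℓ≤B} _ run) = append ℓ≤B (run-output run)
    where
    append : ∀ {xs out n} → ℓ ≤ B → length out ≤ n → length (take ℓ xs ++ out) ≤ B + n
    append {xs} ℓ≤B h = ≤-trans (≤-reflexive (length-++ (take ℓ xs)))
      (+-mono-≤ (≤-trans (≤-reflexive (length-take ℓ xs)) (≤-trans (m⊓n≤m ℓ (length xs)) ℓ≤B)) h)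

  halted-output : ∀ {U s} {π : Program U s} {l mem disk t out disk′ l₀ mem₀} →
    Program.step π l mem ≡ (l₀ , mem₀ , halt) → Run π l mem disk t out disk′ → out ≡ []
  halted-output e (halt _) = refl
  halted-output e (read e′ _) with trans (sym e) e′
  ... | ()
  halted-output e (write e′ _) with trans (sym e) e′
  ... | ()
  halted-output e (report e′ _) with trans (sym e) e′
  ... | ()

  zero-cost-halts : ∀ {U s} {π : Program U s} {l mem disk out disk′} →
    Run π l mem disk 0 out disk′ → ∃[ l₀ ] ∃[ mem₀ ] Program.step π l mem ≡ (l₀ , mem₀ , halt)
  zero-cost-halts (halt e) = _ , _ , e

  length-coordinates : ∀ {U} (ps : List (Point U)) → length (concatMap coordinates ps) ≡ length ps + length ps
  length-coordinates [] = refl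
  length-coordinates (p ∷ ps) =
    cong suc (trans (cong suc (length-coordinates ps)) (sym (+-suc (length ps) (length ps))))

  -- A concrete disk on which the hypothesis `AnswersWithin` can be applied.
  diskOf : Word → List Block → Disk
  diskOf d blocks a with a <? length blocks
  ... | yes a< = List.lookup blocks (fromℕ< a<)
  ... | no _   = Vec.replicate B d

  diskOf-stores : ∀ d blocks → Stores (diskOf d blocks) blocks
  diskOf-stores d blocks i with toℕ i <? length blocks
  ... | yes i< = cong (List.lookup blocks) (fromℕ<-toℕ i i<)
  ... | no i≮  = contradiction (toℕ<n i) i≮

  module _ {U n s : ℕ} (0<U : 0 < U) (U≤ : U ≤ 2 ^ w)
           (D : Structure U n s) (T : ℕ → ℕ) (within : AnswersWithin D T) where
    open Structure D

    private
      disk : PointSet U n → Disk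
      disk P = diskOf (fromℕ< (≤-trans 0<U U≤)) (build P)

      answers : ∀ P q → ∃[ t ] t ≤ T (outputSize P q) × Answers D P q (disk P) t
      answers P q = within P q (disk P) (diskOf-stores _ (build P))

    -- A reported point takes two words, and one I/O emits at most `B` words.
    reporting-bound : ∀ P q → outputSize P q + outputSize P q ≤ T (outputSize P q) * B
    reporting-bound P q with answers P q
    ... | t , t≤ , A = begin
      outputSize P q + outputSize P q        ≡⟨ cong (λ k → k + k) (sym (↭-length correct)) ⟩
      length reported + length reported      ≡⟨ sym (length-coordinates reported) ⟩
      length (concatMap coordinates reported) ≡⟨ cong length (sym encoded) ⟩
      length (List.map toℕ output)           ≡⟨ length-map toℕ output ⟩
      length output                          ≤⟨ run-output run ⟩
      t * B                                  ≤⟨ *-monoˡ-≤ B t≤ ⟩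
      T (outputSize P q) * B                 ∎
      where
      open ≤-Reasoning
      open Answers A

    -- The first instruction is chosen before anything is read, hence from the query alone. If it
    -- halts for `P`, it halts for `P′` too, with no output.
    zero-cost-oblivious : ∀ P P′ q → T (outputSize P q) ≡ 0 → rangeSkyline P′ q ≡ []
    zero-cost-oblivious P P′ q T≡0 with answers P q | answers P′ q
    ... | t , t≤ , A | _ , _ , A′ with n≤0⇒n≡0 (subst (t ≤_) T≡0 t≤)
    ...   | refl with zero-cost-halts (Answers.run A)
    ...     | _ , _ , e = ↭-empty-inv (subst (rangeSkyline P′ q ↭_) (no-points A′.reported
                (trans (sym A′.encoded) (cong (List.map toℕ) (halted-output e A′.run)))) (↭-sym A′.correct))
      where
      module A′ = Answers A′
      no-points : ∀ ps → concatMap coordinates ps ≡ [] → ps ≡ []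
      no-points [] _ = refl

  module _ {n s : ℕ} (0<n : 0 < n) where

    empty-output-costs : ∀ {U} → 0 < U → U ≤ 2 ^ w →
      (D : Structure U n s) (T : ℕ → ℕ) → AnswersWithin D T →
      ∀ (P : PointSet U n) q → outputSize P q ≡ 0 → T 0 ≢ 0
    -- In a universe of one cell every query contains the only point, so its output is never empty.
    empty-output-costs {suc zero} _ _ D T within P q empty _ with firstPoint P 0<n
    ... | (zero , zero) , p∈ = absurd (rangeSkyline P q) empty
        (∈-rangeSkyline P q p∈ (inside (TopOpenQuery.α₁ q) (TopOpenQuery.α₂ q) (TopOpenQuery.β q))
          λ {p′} _ _ → origin p′)
      where
      origin : (p : Point 1) → 0 ≡ xOf p
      origin (zero , _) = refl
      absurd : ∀ xs {p : Point 1} → length xs ≡ 0 → p ∈ xs → ⊥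
      absurd [] _ ()
      inside : ∀ (a b c : Fin 1) → (toℕ a ≤ 0 × 0 ≤ toℕ b) × (toℕ c ≤ 0 × 0 ≤ 1)
      inside zero zero zero = (z≤n , z≤n) , (z≤n , z≤n)
    empty-output-costs {suc (suc u)} 0<U U≤ D T within P _ _ T0≡0 with firstPoint P 0<n
    ... | (x , y) , p∈ = nonempty (zero-cost-oblivious 0<U U≤ D T within low high q
            (trans (cong T low-empty) T0≡0)) found
      where
      top : Fin (suc (suc u))
      top = fromℕ (suc u)
      q : TopOpenQuery (suc (suc u))
      -- A single column at the greatest height: empty once the point of that column is moved to
      -- height 0, nonempty once it is moved to `top`.
      q = record { α₁ = x ; α₂ = x ; β = top }
      low high : PointSet (suc (suc u)) n
      low  = swapHeights P y zero
      high = swapHeights P y top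
      inColumn : ∀ {z : Fin (suc (suc u))} {b t} {p : Point (suc (suc u))} → p ∈ᴿ [ toℕ z , toℕ z ]×[ b , t ] → z ≡ proj₁ p
      inColumn ((l , r) , _) = toℕ-injective (≤-antisym l r)
      found : (x , top) ∈ rangeSkyline high q
      found = ∈-rangeSkyline high q (swapHeights-∈ P y top p∈)
        ((≤-refl , ≤-refl) , ≤-refl , <⇒≤ (toℕ<n top)) λ _ p-in → cong toℕ (inColumn p-in)
      nonempty : rangeSkyline high q ≡ [] → (x , top) ∈ rangeSkyline high q → ⊥
      nonempty e h with subst ((x , top) ∈_) e h
      ... | ()
      low-empty : outputSize low q ≡ 0
      low-empty = cong (length ∘ skyline) (filter-none (_∈ᴿ? TopOpenQuery.rectangle q)
        (All.tabulate λ {p} p∈′ p-in → absent p p∈′ p-in (inColumn p-in)))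
        where
        absent : ∀ p → p ∈ PointSet.points low → p ∈ᴿ TopOpenQuery.rectangle q → ¬ (x ≡ proj₁ p)
        absent (x′ , y′) p∈′ (_ , top≤ , _) refl with swapHeights-unique P y zero p∈ p∈′
        ... | refl with subst (_≤ 0) (toℕ-fromℕ (suc u)) top≤
        ...   | ()

    -- Each of the two summands is at most `T`, whence the factor 2. The quotient is bounded by
    -- reporting; the 1 by reporting too, or by `empty-output-costs` if nothing is reported.
    query-cost : ∀ {U} → 0 < U → U ≤ 2 ^ w →
      (D : Structure U n s) (T : ℕ → ℕ) → AnswersWithin D T →
      ∀ (P : PointSet U n) q → 1 + ⌈ outputSize P q / B ⌉ ≤ 2 * T (outputSize P q)
    query-cost 0<U U≤ D T within P q =
      ≤-trans (+-mono-≤ (positive (outputSize P q) refl) rounded) (≤-reflexive (cong (T k +_) (sym (+-identityʳ (T k)))))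
      where
      k : ℕ
      k = outputSize P q
      2k≤ : k + k ≤ T k * B
      2k≤ = reporting-bound 0<U U≤ D T within P q
      rounded : ⌈ k / B ⌉ ≤ T k
      rounded = ≤-pred (m<n*o⇒m/o<n (begin-strict
        k + (B ∸ 1)    <⟨ +-mono-≤-< (≤-trans (m≤m+n k k) 2k≤) (≤-reflexive (m+[n∸m]≡n (>-nonZero⁻¹ B))) ⟩
        T k * B + B    ≡⟨ +-comm (T k * B) B ⟩
        suc (T k) * B  ∎))
        where open ≤-Reasoning
      positive : ∀ j → k ≡ j → 1 ≤ T k
      positive zero e = n≢0⇒n>0 (subst (λ j → T j ≢ 0) (sym e) (empty-output-costs 0<U U≤ D T within P q e))
      positive (suc j) e = n≢0⇒n>0 λ Tk≡0 →
        contradiction (≤-trans (≤-reflexive (sym e)) (≤-trans (m≤m+n k k) (≤-trans 2k≤ (≤-reflexive (cong (_* B) Tk≡0))))) λ ()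

-- Constants: the number of blocks in terms of `n`, and the two bounds combined.

open Machine using (memorySize; blockSize; wordBits)
open Model using (Structure; AnswersWithin)

n≤⌈n/d⌉*d : ∀ n d .{{_ : NonZero d}} → n ≤ ⌈ n / d ⌉ * d
n≤⌈n/d⌉*d n d = +-cancelʳ-≤ (d ∸ 1) n _ (begin
  n + (d ∸ 1)                                ≡⟨ m≡m%n+[m/n]*n (n + (d ∸ 1)) d ⟩
  (n + (d ∸ 1)) % d + ⌈ n / d ⌉ * d          ≤⟨ +-monoˡ-≤ (⌈ n / d ⌉ * d) (m<n⇒m≤n∸1 (m%n<n (n + (d ∸ 1)) d)) ⟩
  d ∸ 1 + ⌈ n / d ⌉ * d                      ≡⟨ +-comm (d ∸ 1) _ ⟩
  ⌈ n / d ⌉ * d + (d ∸ 1)                    ∎)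
  where
  open ≤-Reasoning
  m<n⇒m≤n∸1 : ∀ {m n} → m < n → m ≤ n ∸ 1
  m<n⇒m≤n∸1 (s≤s h) = h

rankSpace⇒0<n : ∀ {C U n} → RankSpace C U n → 0 < n
rankSpace⇒0<n {C} {n = zero}  (0<U , U≤) rewrite *-zeroʳ C with ≤-trans 0<U U≤
... | ()
rankSpace⇒0<n {n = suc n} _ = s≤s z≤n

records-bound : ∀ {C U n} B .{{_ : NonZero B}} → RankSpace C U n →
  suc (U / B) * 9 ≤ (9 * C + 18) * ⌈ n / B ⌉
records-bound {C} {U} {n} B rank@(_ , U≤) = begin
  suc (U / B) * 9          ≤⟨ *-monoˡ-≤ 9 (+-mono-≤ 1≤N U/B≤) ⟩
  (N + C * N) * 9          ≡⟨ *-comm (N + C * N) 9 ⟩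
  9 * (N + C * N)          ≡⟨ sym (*-assoc 9 (suc C) N) ⟩
  -- The space needs `9 * C + 9`; the surplus lets the same constant bound the 18 I/Os per batch.
  9 * suc C * N            ≤⟨ *-monoˡ-≤ N (≤-trans (≤-reflexive (trans (*-suc 9 C) (+-comm 9 (9 * C)))) (+-monoʳ-≤ (9 * C) (m≤m+n 9 9))) ⟩
  (9 * C + 18) * N         ∎
  where
  open ≤-Reasoning
  N : ℕ
  N = ⌈ n / B ⌉
  1≤N : 1 ≤ N
  1≤N = m≥n⇒m/n>0 (≤-trans (≤-reflexive (sym (m+[n∸m]≡n (>-nonZero⁻¹ B)))) (+-monoˡ-≤ (B ∸ 1) (rankSpace⇒0<n {C} rank)))
  U/B≤ : U / B ≤ C * N
  U/B≤ = ≤-trans (/-monoˡ-≤ B (≤-trans U≤ (≤-trans (*-monoʳ-≤ C (n≤⌈n/d⌉*d n B))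
    (≤-reflexive (sym (*-assoc C N B)))))) (≤-reflexive (m*n/n≡m (C * N) B))

theorem2 : (C : ℕ) →
    (∃[ b ] ∃[ s ] ∃[ c ]
    ((μ : Machine) (U n : ℕ) →
    RankSpace C U n → U ≤ 2 ^ wordBits μ → b * blockSize μ ≤ memorySize μ →
    Σ (Structure μ U n s) λ D →
    (∀ P → Structure.space D P ≤ c * ⌈ n / blockSize μ ⌉) ×
    AnswersWithin μ D (λ k → c * (1 + ⌈ k / blockSize μ ⌉))))
    ×
    (∃[ c ]
    ((μ : Machine) (U n s : ℕ) →
    RankSpace C U n → U ≤ 2 ^ wordBits μ →
    (D : Structure μ U n s) (T : ℕ → ℕ) → AnswersWithin μ D T →
    (P : PointSet U n) (q : TopOpenQuery U) →
    1 + ⌈ outputSize P q / blockSize μ ⌉ ≤ c * T (outputSize P q)))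
theorem2 C =
  (20 , 19 , 9 * C + 18 , λ μ U n rank U≤ fits →
    let instance
          U≢0 = >-nonZero (proj₁ rank)
        open Construction μ U n {{U≢0}} (rankSpace⇒0<n {C} rank) U≤ fits
    in structure
     , (λ P → ≤-trans (≤-reflexive (length-build P)) (records-bound {C} (blockSize μ) rank))
     , λ P q disk stores → let t , t≤ , A = answersWithin P q disk stores
                           in t , ≤-trans t≤ (*-monoˡ-≤ _ (m≤n+m 18 (9 * C))) , A)
  , 2 , λ μ U n s rank U≤ D T within P q →
      LowerBound.query-cost μ (rankSpace⇒0<n {C} rank) (proj₁ rank) U≤ D T within P q
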